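{- Let $m\geq 1$ be an integer, let $\beta\in(0,1)$ be a real number satisfying $\beta^2+m\beta=1$, and let $(G_n)_{n\geq 0}$ be the integer sequence defined by $G_0=0$, $G_1=1$, $G_{n+2}=mG_{n+1}+G_n$ for $n\geq 0$. Let $i\geq 1$ be an integer. For $j\in\mathbb{Z}$ define the integer $\varepsilon_i(j)$ by $$\bigl\lfloor \beta(j+G_i)\bigr\rfloor = \lfloor \beta j\rfloor + G_{i-1} + \varepsilon_i(j).$$ Then for every $j\in\mathbb{Z}$ we have $\varepsilon_i(j)\in\bigl\{0,(-1)^{i+1}\bigr\}$. Moreover, the frequency of integers $j$ for which $\varepsilon_i(j)$ is non-zero exists and equals $\beta^i$, that is, $$\lim_{n\to\infty}\frac{\#\{j\in\mathbb{Z}\mid -n\leq j\leq n,\ \varepsilon_i(j)\neq 0\}}{2n+1}=\beta^i.$$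
   Context: $\lfloor x\rfloor$ denotes the greatest integer not exceeding the real number $x$. -}

module Defs where

open import Data.Integer as ℤ using (ℤ; +_; 0ℤ; 1ℤ)
open import Data.List using (List; length; map; filter; upTo)
open import Data.Nat as ℕ using (ℕ; zero; suc)
open import Data.Nat.Properties as ℕP using ()
open import Data.Product using (_×_; _,_; ∃-syntax)
open import Data.Rational as ℚ using (ℚ; 0ℚ; 1ℚ; ½)
open import Data.Rational.Properties as ℚP using ()
open import Data.Rational.Solver using (module +-*-Solver)
open import Data.Sum using (inj₁; inj₂)
open import Relation.Binary.PropositionalEquality
open import Relation.Nullary using (¬_; ¬?)

-- Real numbers are Cauchy sequences of rationals with a modulus of
-- convergence, compared by the setoid equality _≈_ below.

Cauchy : (ℕ → ℚ) → Set
Cauchy s = ∀ ε → 0ℚ ℚ.< ε →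
  ∃[ N ] (∀ m n → N ℕ.≤ m → N ℕ.≤ n → ℚ.∣ s m ℚ.- s n ∣ ℚ.< ε)

record ℝ : Set where
  constructor mkℝ
  field
    seq    : ℕ → ℚ
    cauchy : Cauchy seq

open ℝ public

infix  4 _≈_ _<_ _≤_ _⟶_ ⌊_⌋≡_
infixl 6 _+_ _-_
infixl 7 _*_
infixr 8 _^_
infix  8 -_

_≈_ : ℝ → ℝ → Set
x ≈ y = ∀ ε → 0ℚ ℚ.< ε →
  ∃[ N ] (∀ n → N ℕ.≤ n → ℚ.∣ seq x n ℚ.- seq y n ∣ ℚ.< ε)

_<_ : ℝ → ℝ → Set
x < y = ∃[ δ ] (0ℚ ℚ.< δ ×
  ∃[ N ] (∀ n → N ℕ.≤ n → seq x n ℚ.+ δ ℚ.≤ seq y n))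

_≤_ : ℝ → ℝ → Set
x ≤ y = ¬ (y < x)

private
  ½-pos : ∀ {ε} → 0ℚ ℚ.< ε → 0ℚ ℚ.< ½ ℚ.* ε
  ½-pos {ε} 0<ε = subst (ℚ._< ½ ℚ.* ε) (ℚP.*-zeroʳ ½) (ℚP.*-monoʳ-<-pos ½ 0<ε)

  ½+½ : ∀ ε → ½ ℚ.* ε ℚ.+ ½ ℚ.* ε ≡ ε
  ½+½ ε = trans (sym (ℚP.*-distribʳ-+ ε ½ ½)) (ℚP.*-identityˡ ε)

  split-+ : ∀ a b c d → (a ℚ.+ b) ℚ.- (c ℚ.+ d) ≡ (a ℚ.- c) ℚ.+ (b ℚ.- d)
  split-+ = solve 4 (λ a b c d →
    (a :+ b) :- (c :+ d) := (a :- c) :+ (b :- d)) refl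
    where open +-*-Solver

  split-* : ∀ a b c d →
    a ℚ.* b ℚ.- c ℚ.* d ≡ a ℚ.* (b ℚ.- d) ℚ.+ d ℚ.* (a ℚ.- c)
  split-* = solve 4 (λ a b c d →
    a :* b :- c :* d := a :* (b :- d) :+ d :* (a :- c)) refl
    where open +-*-Solver

  diff-neg : ∀ a b → ℚ.- a ℚ.- (ℚ.- b) ≡ ℚ.- (a ℚ.- b)
  diff-neg = solve 2 (λ a b → :- a :- (:- b) := :- (a :- b)) refl
    where open +-*-Solver

  diff-swap : ∀ a b → ℚ.- (a ℚ.- b) ≡ b ℚ.- a
  diff-swap = solve 2 (λ a b → :- (a :- b) := b :- a) refl
    where open +-*-Solver

  add-back : ∀ a b → (a ℚ.- b) ℚ.+ b ≡ a
  add-back = solve 2 (λ a b → (a :- b) :+ b := a) refl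
    where open +-*-Solver

  add-sub : ∀ a b → (a ℚ.+ b) ℚ.- b ≡ a
  add-sub = solve 2 (λ a b → (a :+ b) :- b := a) refl
    where open +-*-Solver

  ∣p∣≤∣p-q∣+∣q∣ : ∀ p q → ℚ.∣ p ∣ ℚ.≤ ℚ.∣ p ℚ.- q ∣ ℚ.+ ℚ.∣ q ∣
  ∣p∣≤∣p-q∣+∣q∣ p q = subst (λ r → ℚ.∣ r ∣ ℚ.≤ ℚ.∣ p ℚ.- q ∣ ℚ.+ ℚ.∣ q ∣)
    (add-back p q) (ℚP.∣p+q∣≤∣p∣+∣q∣ (p ℚ.- q) q)

  ∣p∣-∣q∣≤∣p-q∣ : ∀ p q → ℚ.∣ p ∣ ℚ.- ℚ.∣ q ∣ ℚ.≤ ℚ.∣ p ℚ.- q ∣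
  ∣p∣-∣q∣≤∣p-q∣ p q = subst (ℚ.∣ p ∣ ℚ.- ℚ.∣ q ∣ ℚ.≤_)
    (add-sub ℚ.∣ p ℚ.- q ∣ ℚ.∣ q ∣)
    (ℚP.+-monoˡ-≤ (ℚ.- ℚ.∣ q ∣) (∣p∣≤∣p-q∣+∣q∣ p q))

  ∣p-q∣≡∣q-p∣ : ∀ p q → ℚ.∣ p ℚ.- q ∣ ≡ ℚ.∣ q ℚ.- p ∣
  ∣p-q∣≡∣q-p∣ p q =
    trans (sym (ℚP.∣-p∣≡∣p∣ (p ℚ.- q))) (cong ℚ.∣_∣ (diff-swap p q))

  ∣∣p∣-∣q∣∣≤∣p-q∣ : ∀ p q → ℚ.∣ ℚ.∣ p ∣ ℚ.- ℚ.∣ q ∣ ∣ ℚ.≤ ℚ.∣ p ℚ.- q ∣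
  ∣∣p∣-∣q∣∣≤∣p-q∣ p q with ℚP.∣p∣≡p∨∣p∣≡-p (ℚ.∣ p ∣ ℚ.- ℚ.∣ q ∣)
  ... | inj₁ e = subst (ℚ._≤ ℚ.∣ p ℚ.- q ∣) (sym e) (∣p∣-∣q∣≤∣p-q∣ p q)
  ... | inj₂ e = subst₂ ℚ._≤_
    (sym (trans e (diff-swap ℚ.∣ p ∣ ℚ.∣ q ∣))) (∣p-q∣≡∣q-p∣ q p)
    (∣p∣-∣q∣≤∣p-q∣ q p)

  Bounded : (ℕ → ℚ) → Set
  Bounded s = ∃[ B ] (0ℚ ℚ.< B ×
    ∃[ N ] (∀ n → N ℕ.≤ n → ℚ.∣ s n ∣ ℚ.< B))

  cauchy⇒bounded : ∀ {s} → Cauchy s → Bounded s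
  cauchy⇒bounded {s} cs with cs 1ℚ (ℚP.positive⁻¹ 1ℚ)
  ... | N , close = 1ℚ ℚ.+ ℚ.∣ s N ∣ , pos , N , λ n N≤n →
    ℚP.≤-<-trans (∣p∣≤∣p-q∣+∣q∣ (s n) (s N))
      (ℚP.+-monoˡ-< ℚ.∣ s N ∣ (close n N N≤n ℕP.≤-refl))
    where
    pos : 0ℚ ℚ.< 1ℚ ℚ.+ ℚ.∣ s N ∣
    pos = ℚP.+-mono-<-≤ (ℚP.positive⁻¹ 1ℚ) (ℚP.0≤∣p∣ (s N))

  shrink : ∀ B → 0ℚ ℚ.< B → ∀ ε → 0ℚ ℚ.< ε → ∃[ δ ] (0ℚ ℚ.< δ × B ℚ.* δ ≡ ε)
  shrink B 0<B ε 0<ε = ℚ.1/ B ℚ.* ε , pos , eq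
    where
    instance
      B-pos : ℚ.Positive B
      B-pos = ℚ.positive 0<B
      B-nz : ℚ.NonZero B
      B-nz = ℚP.pos⇒nonZero B
    pos : 0ℚ ℚ.< ℚ.1/ B ℚ.* ε
    pos = subst (ℚ._< ℚ.1/ B ℚ.* ε) (ℚP.*-zeroʳ (ℚ.1/ B))
      (ℚP.*-monoʳ-<-pos (ℚ.1/ B) {{ℚP.1/pos⇒pos B}} 0<ε)
    eq : B ℚ.* (ℚ.1/ B ℚ.* ε) ≡ ε
    eq = trans (sym (ℚP.*-assoc B (ℚ.1/ B) ε))
      (trans (cong (ℚ._* ε) (ℚP.*-inverseʳ B)) (ℚP.*-identityˡ ε))

  ∣p*q∣< : ∀ p q {B δ} → 0ℚ ℚ.< B → ℚ.∣ p ∣ ℚ.< B → ℚ.∣ q ∣ ℚ.< δ →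
    ℚ.∣ p ℚ.* q ∣ ℚ.< B ℚ.* δ
  ∣p*q∣< p q {B} {δ} 0<B ∣p∣<B ∣q∣<δ =
    subst (ℚ._< B ℚ.* δ) (sym (ℚP.∣p*q∣≡∣p∣*∣q∣ p q))
      (ℚP.≤-<-trans
        (ℚP.*-monoʳ-≤-nonNeg ℚ.∣ q ∣ {{ℚP.∣-∣-nonNeg q}} (ℚP.<⇒≤ ∣p∣<B))
        (ℚP.*-monoʳ-<-pos B {{ℚ.positive 0<B}} ∣q∣<δ))

  cauchy-const : ∀ q → Cauchy (λ _ → q)
  cauchy-const q ε 0<ε = 0 , λ _ _ _ _ →
    subst (ℚ._< ε) (cong ℚ.∣_∣ (sym (ℚP.+-inverseʳ q))) 0<ε

  cauchy-+ : ∀ {s t} → Cauchy s → Cauchy t → Cauchy (λ n → s n ℚ.+ t n)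
  cauchy-+ {s} {t} cs ct ε 0<ε
    with cs (½ ℚ.* ε) (½-pos 0<ε) | ct (½ ℚ.* ε) (½-pos 0<ε)
  ... | M , p | N , q = M ℕ.⊔ N , λ m n ≤m ≤n →
    subst₂ ℚ._<_ (cong ℚ.∣_∣ (sym (split-+ (s m) (t m) (s n) (t n)))) (½+½ ε)
      (ℚP.≤-<-trans (ℚP.∣p+q∣≤∣p∣+∣q∣ (s m ℚ.- s n) (t m ℚ.- t n))
        (ℚP.+-mono-<
          (p m n (ℕP.m⊔n≤o⇒m≤o M N ≤m) (ℕP.m⊔n≤o⇒m≤o M N ≤n))
          (q m n (ℕP.m⊔n≤o⇒n≤o M N ≤m) (ℕP.m⊔n≤o⇒n≤o M N ≤n))))

  cauchy-neg : ∀ {s} → Cauchy s → Cauchy (λ n → ℚ.- s n)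
  cauchy-neg {s} cs ε 0<ε with cs ε 0<ε
  ... | N , p = N , λ m n ≤m ≤n → subst (ℚ._< ε)
    (sym (trans (cong ℚ.∣_∣ (diff-neg (s m) (s n))) (ℚP.∣-p∣≡∣p∣ (s m ℚ.- s n))))
    (p m n ≤m ≤n)

  cauchy-abs : ∀ {s} → Cauchy s → Cauchy (λ n → ℚ.∣ s n ∣)
  cauchy-abs {s} cs ε 0<ε with cs ε 0<ε
  ... | N , p = N , λ m n ≤m ≤n →
    ℚP.≤-<-trans (∣∣p∣-∣q∣∣≤∣p-q∣ (s m) (s n)) (p m n ≤m ≤n)

  ∣pq-rs∣< : ∀ p q r s {A B α γ ε} → 0ℚ ℚ.< A → 0ℚ ℚ.< B →
    A ℚ.* α ≡ ½ ℚ.* ε → B ℚ.* γ ≡ ½ ℚ.* ε →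
    ℚ.∣ p ∣ ℚ.< A → ℚ.∣ s ∣ ℚ.< B →
    ℚ.∣ q ℚ.- s ∣ ℚ.< α → ℚ.∣ p ℚ.- r ∣ ℚ.< γ →
    ℚ.∣ p ℚ.* q ℚ.- r ℚ.* s ∣ ℚ.< ε
  ∣pq-rs∣< p q r s {A} {B} {α} {γ} {ε} 0<A 0<B Aα≡ Bγ≡ p<A s<B qs<α pr<γ =
    subst (ℚ.∣ p ℚ.* q ℚ.- r ℚ.* s ∣ ℚ.<_) sum≡ε
      (subst (λ x → ℚ.∣ x ∣ ℚ.< A ℚ.* α ℚ.+ B ℚ.* γ) (sym (split-* p q r s))
        (ℚP.≤-<-trans
          (ℚP.∣p+q∣≤∣p∣+∣q∣ (p ℚ.* (q ℚ.- s)) (s ℚ.* (p ℚ.- r)))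
          (ℚP.+-mono-<
            (∣p*q∣< p (q ℚ.- s) 0<A p<A qs<α)
            (∣p*q∣< s (p ℚ.- r) 0<B s<B pr<γ))))
    where
    sum≡ε : A ℚ.* α ℚ.+ B ℚ.* γ ≡ ε
    sum≡ε = trans (cong₂ ℚ._+_ Aα≡ Bγ≡) (½+½ ε)

  cauchy-* : ∀ {s t} → Cauchy s → Cauchy t → Cauchy (λ n → s n ℚ.* t n)
  cauchy-* {s} {t} cs ct ε 0<ε =
    let A , 0<A , K , s<A = cauchy⇒bounded cs
        B , 0<B , L , t<B = cauchy⇒bounded ct
        α , 0<α , Aα≡ = shrink A 0<A (½ ℚ.* ε) (½-pos 0<ε)
        γ , 0<γ , Bγ≡ = shrink B 0<B (½ ℚ.* ε) (½-pos 0<ε)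
        M , p = cs γ 0<γ
        N , q = ct α 0<α
    in K ℕ.⊔ L ℕ.⊔ (M ℕ.⊔ N) , λ m n ≤m ≤n →
      let KL≤m = ℕP.m⊔n≤o⇒m≤o (K ℕ.⊔ L) (M ℕ.⊔ N) ≤m
          KL≤n = ℕP.m⊔n≤o⇒m≤o (K ℕ.⊔ L) (M ℕ.⊔ N) ≤n
          MN≤m = ℕP.m⊔n≤o⇒n≤o (K ℕ.⊔ L) (M ℕ.⊔ N) ≤m
          MN≤n = ℕP.m⊔n≤o⇒n≤o (K ℕ.⊔ L) (M ℕ.⊔ N) ≤n
      in ∣pq-rs∣< (s m) (t m) (s n) (t n) 0<A 0<B Aα≡ Bγ≡
        (s<A m (ℕP.m⊔n≤o⇒m≤o K L KL≤m))
        (t<B n (ℕP.m⊔n≤o⇒n≤o K L KL≤n))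
        (q m n (ℕP.m⊔n≤o⇒n≤o M N MN≤m) (ℕP.m⊔n≤o⇒n≤o M N MN≤n))
        (p m n (ℕP.m⊔n≤o⇒m≤o M N MN≤m) (ℕP.m⊔n≤o⇒m≤o M N MN≤n))

fromℚ : ℚ → ℝ
fromℚ q = mkℝ (λ _ → q) (cauchy-const q)

fromℤ : ℤ → ℝ
fromℤ k = fromℚ (k ℚ./ 1)

0ℝ 1ℝ : ℝ
0ℝ = fromℤ 0ℤ
1ℝ = fromℤ 1ℤ

_+_ : ℝ → ℝ → ℝ
x + y = mkℝ (λ n → seq x n ℚ.+ seq y n) (cauchy-+ {seq x} {seq y} (cauchy x) (cauchy y))

_*_ : ℝ → ℝ → ℝ
x * y = mkℝ (λ n → seq x n ℚ.* seq y n) (cauchy-* {seq x} {seq y} (cauchy x) (cauchy y))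

-_ : ℝ → ℝ
- x = mkℝ (λ n → ℚ.- seq x n) (cauchy-neg {seq x} (cauchy x))

_-_ : ℝ → ℝ → ℝ
x - y = x + (- y)

∣_∣ : ℝ → ℝ
∣ x ∣ = mkℝ (λ n → ℚ.∣ seq x n ∣) (cauchy-abs {seq x} (cauchy x))

_^_ : ℝ → ℕ → ℝ
x ^ zero  = 1ℝ
x ^ suc n = x * x ^ n

_⟶_ : (ℕ → ℝ) → ℝ → Set
a ⟶ x = ∀ δ → 0ℝ < δ → ∃[ N ] (∀ n → N ℕ.≤ n → ∣ a n - x ∣ < δ)

-- Constructively the floor is not a total function ℝ → ℤ, so it is given by
-- its graph: k is the greatest integer not exceeding x.

⌊_⌋≡_ : ℝ → ℤ → Set
⌊ x ⌋≡ k = fromℤ k ≤ x × (∀ l → fromℤ l ≤ x → l ℤ.≤ k)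

G : ℕ → ℕ → ℤ
G m zero          = 0ℤ
G m (suc zero)    = 1ℤ
G m (suc (suc n)) = + m ℤ.* G m (suc n) ℤ.+ G m n

-- The defining equation of e = ε_i(j), for i ≥ 1.

Isε : ℕ → ℝ → ℕ → ℤ → ℤ → Set
Isε m β i j e = ∃[ k ] ∃[ l ]
  ( ⌊ β * fromℤ j ⌋≡ k
  × ⌊ β * fromℤ (j ℤ.+ G m i) ⌋≡ l
  × l ≡ k ℤ.+ G m (i ℕ.∸ 1) ℤ.+ e )

[-_⋯_] : ℕ → ℕ → List ℤ
[- a ⋯ b ] = map (λ k → + k ℤ.- + a) (upTo (suc (a ℕ.+ b)))

#nonzero : (ℤ → ℤ) → ℕ → ℕ
#nonzero ε n = length (filter (λ j → ¬? (ε j ℤ.≟ 0ℤ)) [- n ⋯ n ])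

frequency : (ℤ → ℤ) → ℕ → ℝ
frequency ε n = fromℚ (+ #nonzero ε n ℚ./ suc (2 ℕ.* n))

{-# OPTIONS --safe #-}
module Submission where

-- Write s = (-1)^(i+1). Since β G_i = G_{i-1} + s β^i, the number ε_i(j) is the
-- integer part of {βj} + s β^i with 0 < β^i < 1, hence lies in {0, s}. Thus s
-- times the number of j with ε_i(j) ≠ 0 in an interval of N integers is the sum
-- of ε_i over it. The sum of ⌊β(j+G)⌋ − ⌊βj⌋ over the interval telescopes into G
-- differences ⌊β(r+N)⌋ − ⌊βr⌋, each within 1 of βN, so the number differs from
-- N β^i by at most G_i.
--
-- Inequalities between reals are read off their rational sequences: Pos and NonNeg
-- express x > 0 and x ≥ 0, and a linear combination of inequalities only needs a
-- ring identity at each index.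

open import Defs
open import Data.Integer as ℤ using (ℤ; +_; -[1+_]; 0ℤ; 1ℤ; -1ℤ)
import Data.Integer.Properties as ℤP
open import Data.Integer.Solver using () renaming (module +-*-Solver to ℤ-Solver)
open import Data.List using (length; filter; applyUpTo)
open import Data.List.Properties using (map-upTo)
open import Data.Nat as ℕ using (ℕ; zero; suc)
import Data.Nat.Properties as ℕP
open import Data.Product using (_×_; Σ-syntax; ∃-syntax; _,_; proj₁; proj₂)
open import Data.Rational as ℚ using (ℚ; 0ℚ; 1ℚ; ½)
import Data.Rational.Properties as ℚP
open import Data.Rational.Solver using (module +-*-Solver)
import Data.Rational.Unnormalised as ℚᵘ
import Data.Rational.Unnormalised.Properties as ℚᵘP
open import Data.Sum using (_⊎_; inj₁; inj₂)
open import Function using (_∘_)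
open import Relation.Binary.Definitions using (Tri; tri<; tri≈; tri>)
open import Relation.Binary.PropositionalEquality
  using (_≡_; _≢_; refl; sym; trans; cong; cong₂; subst; subst₂)
open import Relation.Nullary using (¬_; ¬?; yes; no; contradiction)
open +-*-Solver using (solve; con; _:+_; _:-_; _:*_; :-_; _:=_)
open ℤ-Solver using ()
  renaming (con to conℤ; _:+_ to _⊕_; _:-_ to _⊖_; _:*_ to _⊗_; _:=_ to _⊜_)

-- Rational inequalities and the embedding of the integers.

<⇒≱ : ∀ {p q} → p ℚ.< q → ¬ (q ℚ.≤ p)
<⇒≱ p<q q≤p = ℚP.<-irrefl refl (ℚP.<-≤-trans p<q q≤p)

0≤* : ∀ {p q} → 0ℚ ℚ.≤ p → 0ℚ ℚ.≤ q → 0ℚ ℚ.≤ p ℚ.* q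
0≤* {p} {q} 0≤p 0≤q = subst (ℚ._≤ p ℚ.* q) (ℚP.*-zeroʳ p)
  (ℚP.*-monoˡ-≤-nonNeg p {{ℚ.nonNegative 0≤p}} 0≤q)

0<* : ∀ {p q} → 0ℚ ℚ.< p → 0ℚ ℚ.< q → 0ℚ ℚ.< p ℚ.* q
0<* {p} {q} 0<p 0<q = subst (ℚ._< p ℚ.* q) (ℚP.*-zeroʳ p)
  (ℚP.*-monoʳ-<-pos p {{ℚ.positive 0<p}} 0<q)

0≤1 : 0ℚ ℚ.≤ 1ℚ
0≤1 = ℚP.nonNegative⁻¹ 1ℚ

0<1 : 0ℚ ℚ.< 1ℚ
0<1 = ℚP.positive⁻¹ 1ℚ

0<½ : 0ℚ ℚ.< ½
0<½ = ℚP.positive⁻¹ ½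

p≤q⇒0≤q-p : ∀ {p q} → p ℚ.≤ q → 0ℚ ℚ.≤ q ℚ.- p
p≤q⇒0≤q-p {p} {q} p≤q =
  subst (ℚ._≤ q ℚ.- p) (ℚP.+-inverseʳ p) (ℚP.+-monoˡ-≤ (ℚ.- p) p≤q)

0≤q-p⇒p≤q : ∀ {p q} → 0ℚ ℚ.≤ q ℚ.- p → p ℚ.≤ q
0≤q-p⇒p≤q {p} {q} h = subst₂ ℚ._≤_ (ℚP.+-identityˡ p)
  (solve 2 (λ p q → q :- p :+ p := q) refl p q) (ℚP.+-monoˡ-≤ p h)

divide : ∀ {c ε} → 0ℚ ℚ.< c → 0ℚ ℚ.< ε → ∃[ δ ] (0ℚ ℚ.< δ × c ℚ.* δ ≡ ε)
divide {c} {ε} 0<c 0<ε = ℚ.1/ c ℚ.* ε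
  , 0<* (ℚP.positive⁻¹ (ℚ.1/ c) {{ℚP.1/pos⇒pos c}}) 0<ε
  , trans (sym (ℚP.*-assoc c (ℚ.1/ c) ε))
      (trans (cong (ℚ._* ε) (ℚP.*-inverseʳ c)) (ℚP.*-identityˡ ε))
  where
  instance
    c-pos : ℚ.Positive c
    c-pos = ℚ.positive 0<c
    c-nonZero : ℚ.NonZero c
    c-nonZero = ℚP.pos⇒nonZero c

-- By definition every term of `fromℤ z`, so facts about `ι` apply to real numbers without
-- conversion.
ι : ℤ → ℚ
ι z = z ℚ./ 1

private
  ιᵘ : ℤ → ℚᵘ.ℚᵘ
  ιᵘ z = ℚᵘ.mkℚᵘ z 0

  toℚᵘ-ι : ∀ z → ℚ.toℚᵘ (ι z) ℚᵘ.≃ ιᵘ z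
  toℚᵘ-ι z = ℚP.toℚᵘ-fromℚᵘ (ιᵘ z)

-- The quotient by 1 is normalised and does not compute on variables. Among unnormalised fractions
-- the law is a cross-multiplication, and it is carried back from there.
ι-+ : ∀ a b → ι (a ℤ.+ b) ≡ ι a ℚ.+ ι b
ι-+ a b = ℚP.toℚᵘ-injective (begin
  ℚ.toℚᵘ (ι (a ℤ.+ b))              ≈⟨ toℚᵘ-ι (a ℤ.+ b) ⟩
  ιᵘ (a ℤ.+ b)                      ≈⟨ ℚᵘ.*≡* (cong (ℤ._* 1ℤ)
    (sym (cong₂ ℤ._+_ (ℤP.*-identityʳ a) (ℤP.*-identityʳ b)))) ⟩
  ιᵘ a ℚᵘ.+ ιᵘ b                    ≈⟨ ℚᵘP.+-cong (toℚᵘ-ι a) (toℚᵘ-ι b) ⟨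
  ℚ.toℚᵘ (ι a) ℚᵘ.+ ℚ.toℚᵘ (ι b)    ≈⟨ ℚP.toℚᵘ-homo-+ (ι a) (ι b) ⟨
  ℚ.toℚᵘ (ι a ℚ.+ ι b)              ∎)
  where open ℚᵘP.≃-Reasoning

ι-* : ∀ a b → ι (a ℤ.* b) ≡ ι a ℚ.* ι b
ι-* a b = ℚP.toℚᵘ-injective (begin
  ℚ.toℚᵘ (ι (a ℤ.* b))              ≈⟨ toℚᵘ-ι (a ℤ.* b) ⟩
  ιᵘ a ℚᵘ.* ιᵘ b                    ≈⟨ ℚᵘP.*-cong (toℚᵘ-ι a) (toℚᵘ-ι b) ⟨
  ℚ.toℚᵘ (ι a) ℚᵘ.* ℚ.toℚᵘ (ι b)    ≈⟨ ℚP.toℚᵘ-homo-* (ι a) (ι b) ⟨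
  ℚ.toℚᵘ (ι a ℚ.* ι b)              ∎)
  where open ℚᵘP.≃-Reasoning

ι-neg : ∀ a → ι (ℤ.- a) ≡ ℚ.- ι a
ι-neg a = ℚP.toℚᵘ-injective (begin
  ℚ.toℚᵘ (ι (ℤ.- a))       ≈⟨ toℚᵘ-ι (ℤ.- a) ⟩
  ℚᵘ.- ιᵘ a                ≈⟨ ℚᵘP.-‿cong (toℚᵘ-ι a) ⟨
  ℚᵘ.- ℚ.toℚᵘ (ι a)        ≈⟨ ℚP.toℚᵘ-homo‿- (ι a) ⟨
  ℚ.toℚᵘ (ℚ.- ι a)         ∎)
  where open ℚᵘP.≃-Reasoning

ι-- : ∀ a b → ι (a ℤ.- b) ≡ ι a ℚ.- ι b
ι-- a b = trans (ι-+ a (ℤ.- b)) (cong (ι a ℚ.+_) (ι-neg b))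

ι-mono-≤ : ∀ {a b} → a ℤ.≤ b → ι a ℚ.≤ ι b
ι-mono-≤ {a} {b} a≤b = ℚP.toℚᵘ-cancel-≤ (ℚᵘP.≤-respˡ-≃ (ℚᵘP.≃-sym (toℚᵘ-ι a))
  (ℚᵘP.≤-respʳ-≃ (ℚᵘP.≃-sym (toℚᵘ-ι b)) (ℚᵘ.*≤* (ℤP.*-monoʳ-≤-nonNeg 1ℤ a≤b))))

ι-cancel-< : ∀ {a b} → ι a ℚ.< ι b → a ℤ.< b
ι-cancel-< {a} {b} ιa<ιb with a ℤ.<? b
... | yes a<b = a<b
... | no  a≮b = contradiction (ι-mono-≤ (ℤP.≮⇒≥ a≮b)) (<⇒≱ ιa<ιb)

0≤ι : ∀ n → 0ℚ ℚ.≤ ι (+ n)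
0≤ι n = ι-mono-≤ (ℤ.+≤+ (ℕ.z≤n {n}))

0<ι : ∀ n → 0ℚ ℚ.< ι (+ suc n)
0<ι n = ℚP.<-≤-trans 0<1 (ι-mono-≤ (ℤ.+≤+ (ℕ.s≤s (ℕ.z≤n {n}))))

ι-suc : ∀ n → ι (+ suc n) ≡ 1ℚ ℚ.+ ι (+ n)
ι-suc n = ι-+ 1ℤ (+ n)

-- Positive, nonnegative and null sequences of rationals.

Eventually : (ℕ → Set) → Set
Eventually P = ∃[ N ] (∀ n → N ℕ.≤ n → P n)

eventually-map₂ : ∀ {P Q R : ℕ → Set} → (∀ n → P n → Q n → R n) →
  Eventually P → Eventually Q → Eventually R
eventually-map₂ f (M , p) (N , q) = M ℕ.⊔ N , λ n ≤n →
  f n (p n (ℕP.m⊔n≤o⇒m≤o M N ≤n)) (q n (ℕP.m⊔n≤o⇒n≤o M N ≤n))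

eventually-map : ∀ {P Q : ℕ → Set} → (∀ n → P n → Q n) → Eventually P → Eventually Q
eventually-map f (M , p) = M , λ n ≤n → f n (p n ≤n)

-- A uniform gap is required because a sequence of positive terms may still converge to 0.
record Pos (s : ℕ → ℚ) : Set where
  constructor pos
  field
    {gap}  : ℚ
    0<gap  : 0ℚ ℚ.< gap
    gap≤   : Eventually (λ n → gap ℚ.≤ s n)

-- The slack η is there because a sequence with limit 0 may have negative terms throughout.
record NonNeg (s : ℕ → ℚ) : Set where
  constructor nonNeg
  field
    0≤+ : ∀ {η} → 0ℚ ℚ.< η → Eventually (λ n → 0ℚ ℚ.≤ s n ℚ.+ η)

open NonNeg

private variable
  s t w : ℕ → ℚ

Pos-ext : (∀ n → s n ≡ t n) → Pos s → Pos t
Pos-ext e (pos {δ} 0<δ h) =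
  pos 0<δ (eventually-map (λ n → subst (δ ℚ.≤_) (e n)) h)

NonNeg-ext : (∀ n → s n ≡ t n) → NonNeg s → NonNeg t
NonNeg-ext e h = nonNeg λ {η} 0<η →
  eventually-map (λ n → subst (λ x → 0ℚ ℚ.≤ x ℚ.+ η) (e n)) (0≤+ h 0<η)

private
  0≤+η : ∀ {p η} → 0ℚ ℚ.≤ p → 0ℚ ℚ.< η → 0ℚ ℚ.≤ p ℚ.+ η
  0≤+η 0≤p 0<η = ℚP.+-mono-≤ 0≤p (ℚP.<⇒≤ 0<η)

Pos⇒NonNeg : Pos s → NonNeg s
Pos⇒NonNeg (pos 0<δ h) = nonNeg λ 0<η →
  eventually-map (λ n δ≤ → 0≤+η (ℚP.≤-trans (ℚP.<⇒≤ 0<δ) δ≤) 0<η) h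

NonNeg-const : ∀ {c} → 0ℚ ℚ.≤ c → NonNeg (λ _ → c)
NonNeg-const 0≤c = nonNeg λ 0<η → 0 , λ _ _ → 0≤+η 0≤c 0<η

Pos-const : ∀ {c} → 0ℚ ℚ.< c → Pos (λ _ → c)
Pos-const 0<c = pos 0<c (0 , λ _ _ → ℚP.≤-refl)

Pos-const⁻¹ : ∀ {c} → Pos (λ _ → c) → 0ℚ ℚ.< c
Pos-const⁻¹ (pos 0<δ (N , h)) = ℚP.<-≤-trans 0<δ (h N ℕP.≤-refl)

-- Half of the gap of `s` pays for the slack of `t`; the other half remains as the gap of the sum.
Pos-+-NonNeg : Pos s → NonNeg t → Pos (λ n → s n ℚ.+ t n)
Pos-+-NonNeg {s} {t} (pos {δ} 0<δ h) k =
  pos (0<* 0<½ 0<δ) (eventually-map₂ add h (0≤+ k (0<* 0<½ 0<δ)))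
  where
  add : ∀ n → δ ℚ.≤ s n → 0ℚ ℚ.≤ t n ℚ.+ ½ ℚ.* δ → ½ ℚ.* δ ℚ.≤ s n ℚ.+ t n
  add n δ≤ 0≤ = 0≤q-p⇒p≤q (subst (0ℚ ℚ.≤_)
    (solve 3 (λ δ s t → s :- δ :+ (t :+ con ½ :* δ) := s :+ t :- con ½ :* δ)
      refl δ (s n) (t n))
    (ℚP.+-mono-≤ (p≤q⇒0≤q-p δ≤) 0≤))

NonNeg-+ : NonNeg s → NonNeg t → NonNeg (λ n → s n ℚ.+ t n)
NonNeg-+ {s} {t} h k = nonNeg λ {η} 0<η →
  eventually-map₂
    (λ n p q → subst (0ℚ ℚ.≤_)
      (solve 3 (λ s t η → s :+ con ½ :* η :+ (t :+ con ½ :* η) := s :+ t :+ η)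
        refl (s n) (t n) η)
      (ℚP.+-mono-≤ p q))
    (0≤+ h (0<* 0<½ 0<η)) (0≤+ k (0<* 0<½ 0<η))

Pos-+ : Pos s → Pos t → Pos (λ n → s n ℚ.+ t n)
Pos-+ h k = Pos-+-NonNeg h (Pos⇒NonNeg k)

Pos-* : Pos s → Pos t → Pos (λ n → s n ℚ.* t n)
Pos-* {s} {t} (pos {δ} 0<δ h) (pos {γ} 0<γ k) = pos (0<* 0<δ 0<γ) (eventually-map₂
  (λ n δ≤ γ≤ → ℚP.≤-trans
    (ℚP.*-monoˡ-≤-nonNeg δ {{ℚ.nonNegative (ℚP.<⇒≤ 0<δ)}} γ≤)
    (ℚP.*-monoʳ-≤-nonNeg (t n)
      {{ℚ.nonNegative (ℚP.≤-trans (ℚP.<⇒≤ 0<γ) γ≤)}} δ≤)) h k)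

NonNeg-scale : ∀ {c} → 0ℚ ℚ.≤ c → NonNeg s → NonNeg (λ n → c ℚ.* s n)
NonNeg-scale {s} {c} 0≤c h = nonNeg λ {η} 0<η →
  -- The slack is γ = η / (c + 1) rather than η / c, so that c = 0 is allowed; the surplus γ is
  -- added as a nonnegative term.
  let γ , 0<γ , eq = divide (ℚP.+-mono-≤-< 0≤c 0<1) 0<η in
  eventually-map
    (λ n p → subst (0ℚ ℚ.≤_)
      (trans (solve 3 (λ c x γ → c :* (x :+ γ) :+ γ := c :* x :+ (c :+ con 1ℚ) :* γ)
               refl c (s n) γ)
             (cong (c ℚ.* s n ℚ.+_) eq))
      (ℚP.+-mono-≤ (0≤* 0≤c p) (ℚP.<⇒≤ 0<γ)))
    (0≤+ h 0<γ)

-- The identity st + η = t(s + η) + η(1 - t) shows that a factor between 0 and 1 does not enlarge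
-- the slack.
NonNeg-*-unit : NonNeg s → Pos t → Pos (λ n → 1ℚ ℚ.- t n) → NonNeg (λ n → s n ℚ.* t n)
NonNeg-*-unit {s} {t} h (pos 0<δ k) (pos 0<γ l) = nonNeg λ {η} 0<η →
  eventually-map₂
    (λ n p (q , r) → subst (0ℚ ℚ.≤_)
      (solve 3 (λ s t η → t :* (s :+ η) :+ η :* (con 1ℚ :- t) := s :* t :+ η)
        refl (s n) (t n) η)
      (ℚP.+-mono-≤ (0≤* (ℚP.≤-trans (ℚP.<⇒≤ 0<δ) q) p)
        (0≤* (ℚP.<⇒≤ 0<η) (ℚP.≤-trans (ℚP.<⇒≤ 0<γ) r))))
    (0≤+ h 0<η) (eventually-map₂ (λ _ → _,_) k l)

-- From s w ≥ δ and 0 < w ≤ M follows s ≥ δ / M.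
Pos-*-cancelʳ : ∀ M → 0ℚ ℚ.< M → Pos (λ n → s n ℚ.* w n) → Pos w →
  Pos (λ n → M ℚ.- w n) → Pos s
Pos-*-cancelʳ {s} {w} M 0<M (pos {δ} 0<δ h) (pos {γ} 0<γ k) (pos {θ} 0<θ l)
  with divide 0<M 0<δ
... | α , 0<α , Mα≡δ = pos 0<α (eventually-map₂ α≤s h (eventually-map₂ (λ _ → _,_) k l))
  where
  α≤s : ∀ n → δ ℚ.≤ s n ℚ.* w n → γ ℚ.≤ w n × θ ℚ.≤ M ℚ.- w n → α ℚ.≤ s n
  α≤s n p (q , r) with α ℚ.≤? s n
  ... | yes α≤s = α≤s
  ... | no  α≰s = contradiction p (<⇒≱ (ℚP.<-≤-trans
    (ℚP.*-monoˡ-<-pos (w n) {{ℚ.positive (ℚP.<-≤-trans 0<γ q)}} (ℚP.≰⇒> α≰s))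
    (subst (α ℚ.* w n ℚ.≤_) (trans (ℚP.*-comm α M) Mα≡δ)
      (ℚP.*-monoˡ-≤-nonNeg α {{ℚ.nonNegative (ℚP.<⇒≤ 0<α)}}
        (0≤q-p⇒p≤q (ℚP.≤-trans (ℚP.<⇒≤ 0<θ) r))))))

-- With w ≥ κ > 0, the slack ηκ for the product gives (s + η)w = (sw + ηκ) + η(w - κ) ≥ 0.
NonNeg-*-cancelʳ : NonNeg (λ n → s n ℚ.* w n) → Pos w → NonNeg s
NonNeg-*-cancelʳ {s} {w} h (pos {κ} 0<κ k) = nonNeg λ {η} 0<η →
  eventually-map₂ (λ n p κ≤w → 0≤s+η n 0<η κ≤w p)
    (0≤+ h (0<* 0<η 0<κ)) k
  where
  0≤s+η : ∀ n {η} → 0ℚ ℚ.< η → κ ℚ.≤ w n → 0ℚ ℚ.≤ s n ℚ.* w n ℚ.+ η ℚ.* κ →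
    0ℚ ℚ.≤ s n ℚ.+ η
  0≤s+η n {η} 0<η κ≤w p = ℚP.*-cancelʳ-≤-pos (w n) {{ℚ.positive (ℚP.<-≤-trans 0<κ κ≤w)}}
    (subst₂ ℚ._≤_ (sym (ℚP.*-zeroˡ (w n)))
      (solve 4 (λ s w η κ → s :* w :+ η :* κ :+ η :* (w :- κ) := (s :+ η) :* w)
        refl (s n) (w n) η κ)
      (ℚP.+-mono-≤ p (0≤* (ℚP.<⇒≤ 0<η) (p≤q⇒0≤q-p κ≤w))))

-- Convergence to 0, split into two one-sided halves so that an equality of reals can be added to an
-- inequality in either direction.
Null : (ℕ → ℚ) → Set
Null s = NonNeg s × NonNeg (λ n → ℚ.- s n)

Null-ext : (∀ n → s n ≡ t n) → Null s → Null t
Null-ext e (h , k) = NonNeg-ext e h , NonNeg-ext (λ n → cong ℚ.-_ (e n)) k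

Null-0 : Null (λ _ → 0ℚ)
Null-0 = NonNeg-const ℚP.≤-refl , NonNeg-const ℚP.≤-refl

Null-neg : Null s → Null (λ n → ℚ.- s n)
Null-neg {s} (h , k) =
  k , NonNeg-ext (λ n → solve 1 (λ x → x := :- (:- x)) refl (s n)) h

Null-+ : Null s → Null t → Null (λ n → s n ℚ.+ t n)
Null-+ {s} {t} (h , k) (h′ , k′) = NonNeg-+ h h′ ,
  NonNeg-ext (λ n → solve 2 (λ x y → :- x :+ :- y := :- (x :+ y)) refl (s n) (t n))
    (NonNeg-+ k k′)

Null-scale : ∀ {c} → 0ℚ ℚ.≤ c → Null s → Null (λ n → c ℚ.* s n)
Null-scale {s} {c} 0≤c (h , k) = NonNeg-scale 0≤c h ,
  NonNeg-ext (λ n → solve 2 (λ c x → c :* (:- x) := :- (c :* x)) refl c (s n))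
    (NonNeg-scale 0≤c k)

Null-*-unit : Null s → Pos t → Pos (λ n → 1ℚ ℚ.- t n) → Null (λ n → s n ℚ.* t n)
Null-*-unit {s} {t} (h , k) p q = NonNeg-*-unit h p q ,
  NonNeg-ext (λ n → solve 2 (λ x y → (:- x) :* y := :- (x :* y)) refl (s n) (t n))
    (NonNeg-*-unit k p q)

-- Division by a positive integer and the Archimedean property.

suc*[/suc] : ∀ a d → ι (+ suc d) ℚ.* (a ℚ./ suc d) ≡ ι a
suc*[/suc] a d = ℚP.toℚᵘ-injective (begin
  ℚ.toℚᵘ (ι (+ suc d) ℚ.* (a ℚ./ suc d))
    ≈⟨ ℚP.toℚᵘ-homo-* (ι (+ suc d)) (a ℚ./ suc d) ⟩
  ℚ.toℚᵘ (ι (+ suc d)) ℚᵘ.* ℚ.toℚᵘ (a ℚ./ suc d)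
    ≈⟨ ℚᵘP.*-cong (toℚᵘ-ι (+ suc d)) (ℚP.toℚᵘ-fromℚᵘ (ℚᵘ.mkℚᵘ a d)) ⟩
  ιᵘ (+ suc d) ℚᵘ.* ℚᵘ.mkℚᵘ a d
    ≈⟨ ℚᵘ.*≡* cross ⟩
  ιᵘ a
    ≈⟨ toℚᵘ-ι a ⟨
  ℚ.toℚᵘ (ι a) ∎)
  where
  open ℚᵘP.≃-Reasoning
  cross : (+ suc d ℤ.* a) ℤ.* 1ℤ ≡ a ℤ.* + suc (d ℕ.+ 0)
  cross = trans (ℤP.*-identityʳ _) (trans (ℤP.*-comm (+ suc d) a)
    (cong (λ k → a ℤ.* + suc k) (sym (ℕP.+-identityʳ d))))

-- Take n to be c times the denominator of p: then np is c times the numerator, which is at least 1.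
archimedean : ∀ c {p} → 0ℚ ℚ.< p → ∃[ n ] ι (+ c) ℚ.≤ ι (+ n) ℚ.* p
archimedean c {p} 0<p = c ℕ.* ℚ.↧ₙ p , subst (ι (+ c) ℚ.≤_)
  (trans (cong (ι (+ c) ℚ.*_) (sym ↧*p≡↥))
    (trans (sym (ℚP.*-assoc (ι (+ c)) (ι (ℚ.↧ p)) p))
      (cong (ℚ._* p) (trans (sym (ι-* (+ c) (ℚ.↧ p)))
        (cong ι (sym (ℤP.pos-* c (ℚ.↧ₙ p))))))))
  (subst (ℚ._≤ ι (+ c) ℚ.* ι (ℚ.↥ p)) (ℚP.*-identityʳ (ι (+ c)))
    (ℚP.*-monoˡ-≤-nonNeg (ι (+ c)) {{ℚ.nonNegative (0≤ι c)}} 1≤↥))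
  where
  ↧*p≡↥ : ι (ℚ.↧ p) ℚ.* p ≡ ι (ℚ.↥ p)
  ↧*p≡↥ = trans (cong (ι (ℚ.↧ p) ℚ.*_) (sym (ℚP.↥p/↧p≡p p)))
    (suc*[/suc] (ℚ.↥ p) (ℚ.ℚ.denominator-1 p))

  1≤↥ : 1ℚ ℚ.≤ ι (ℚ.↥ p)
  1≤↥ = ι-mono-≤ (ℤP.i<j⇒suc[i]≤j (ι-cancel-< {0ℤ} {ℚ.↥ p}
    (subst (0ℚ ℚ.<_) ↧*p≡↥ (0<* (0<ι (ℚ.ℚ.denominator-1 p)) 0<p))))

p≤q∧-p≤q⇒∣p∣≤q : ∀ {p q} → p ℚ.≤ q → ℚ.- p ℚ.≤ q → ℚ.∣ p ∣ ℚ.≤ q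
p≤q∧-p≤q⇒∣p∣≤q {p} {q} p≤q -p≤q with ℚP.∣p∣≡p∨∣p∣≡-p p
... | inj₁ e = subst (ℚ._≤ q) (sym e) p≤q
... | inj₂ e = subst (ℚ._≤ q) (sym e) -p≤q

-- Here r is the quotient C / N, and the hypotheses bound the distance of C from Ny by g + 1;
-- dividing by N gives the claim. The 1 beside g leaves room for the slack in `NonNeg`.
∣C/N-y∣≤h : ∀ {N C r y g h} → 0ℚ ℚ.< N → N ℚ.* r ≡ C → 1ℚ ℚ.+ g ℚ.≤ N ℚ.* h →
  0ℚ ℚ.≤ g ℚ.+ N ℚ.* y ℚ.- C ℚ.+ 1ℚ → 0ℚ ℚ.≤ g ℚ.+ C ℚ.- N ℚ.* y ℚ.+ 1ℚ →
  ℚ.∣ r ℚ.- y ∣ ℚ.≤ h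
∣C/N-y∣≤h {N} {C} {r} {y} {g} {h} 0<N refl 1+g≤Nh p q =
  p≤q∧-p≤q⇒∣p∣≤q (cancel (r ℚ.- y) upper-bound) (cancel (ℚ.- (r ℚ.- y)) lower-bound)
  where
  cancel : ∀ u → N ℚ.* u ℚ.≤ 1ℚ ℚ.+ g → u ℚ.≤ h
  cancel u Nu≤ = ℚP.*-cancelˡ-≤-pos N {{ℚ.positive 0<N}} (ℚP.≤-trans Nu≤ 1+g≤Nh)

  upper-bound : N ℚ.* (r ℚ.- y) ℚ.≤ 1ℚ ℚ.+ g
  upper-bound = 0≤q-p⇒p≤q (subst (0ℚ ℚ.≤_)
    (solve 4 (λ g N y r → g :+ N :* y :- N :* r :+ con 1ℚ
                       := con 1ℚ :+ g :- N :* (r :- y)) refl g N y r) p)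

  lower-bound : N ℚ.* (ℚ.- (r ℚ.- y)) ℚ.≤ 1ℚ ℚ.+ g
  lower-bound = 0≤q-p⇒p≤q (subst (0ℚ ℚ.≤_)
    (solve 4 (λ g N y r → g :+ N :* r :- N :* y :+ con 1ℚ
                       := con 1ℚ :+ g :- N :* (:- (r :- y))) refl g N y r) q)

-- Finite integer sums, telescoping and counting.

sum : (ℕ → ℤ) → ℕ → ℤ
sum h zero    = 0ℤ
sum h (suc n) = h 0 ℤ.+ sum (h ∘ suc) n

sum-const+ : ∀ {u v} c → (∀ k → u k ≡ c ℤ.+ v k) → ∀ n →
  sum u n ≡ + n ℤ.* c ℤ.+ sum v n
sum-const+ c e zero = sym (trans (ℤP.+-identityʳ (0ℤ ℤ.* c)) (ℤP.*-zeroˡ c))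
sum-const+ {u} {v} c e (suc n) = trans
  (cong₂ ℤ._+_ (e 0) (sum-const+ {u ∘ suc} {v ∘ suc} c (e ∘ suc) n))
  (ℤ-Solver.solve 4 (λ c v n s → c ⊕ v ⊕ (n ⊗ c ⊕ s)
                   ⊜ (conℤ 1ℤ ⊕ n) ⊗ c ⊕ (v ⊕ s))
    refl c (v 0) (+ n) (sum (v ∘ suc) n))

sum-shift-zero : ∀ (F : ℕ → ℤ) n → sum (λ k → F (k ℕ.+ 0) ℤ.- F k) n ≡ 0ℤ
sum-shift-zero F zero = refl
sum-shift-zero F (suc n) =
  cong₂ ℤ._+_ (ℤP.+-inverseʳ (F 0)) (sum-shift-zero (F ∘ suc) n)

-- Raising the shift by one adds the sum of F(k + g + 1) - F(k + g) over k < n, which telescopes.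
-- Iterated over g, this trades a sum of n differences of span g for g differences of span n.
sum-shift-suc : ∀ (F : ℕ → ℤ) g n →
  sum (λ k → F (k ℕ.+ suc g) ℤ.- F k) n ≡
  sum (λ k → F (k ℕ.+ g) ℤ.- F k) n ℤ.+ (F (n ℕ.+ g) ℤ.- F g)
sum-shift-suc F g zero = sym (trans (ℤP.+-identityˡ _) (ℤP.+-inverseʳ (F g)))
sum-shift-suc F g (suc n) = trans
  (cong (λ z → F (suc g) ℤ.- F 0 ℤ.+ z) (sum-shift-suc (F ∘ suc) g n))
  (ℤ-Solver.solve 5 (λ a b s c d → a ⊖ b ⊕ (s ⊕ (c ⊖ a)) ⊜ d ⊖ b ⊕ s ⊕ (c ⊖ d))
    refl (F (suc g)) (F 0) (sum (λ k → F (suc (k ℕ.+ g)) ℤ.- F (suc k)) n)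
    (F (suc n ℕ.+ g)) (F g))

-- Every nonzero term equals s, so each counted index contributes exactly s to the sum.
count-nonzero : ∀ (ε : ℤ → ℤ) (p : ℕ → ℤ) {s} → s ≢ 0ℤ →
  (∀ j → ε j ≡ 0ℤ ⊎ ε j ≡ s) → ∀ n →
  s ℤ.* + length (filter (λ j → ¬? (ε j ℤ.≟ 0ℤ)) (applyUpTo p n)) ≡ sum (ε ∘ p) n
count-nonzero ε p {s} s≢0 range zero = ℤP.*-zeroʳ s
count-nonzero ε p {s} s≢0 range (suc n)
  with ε (p 0) ℤ.≟ 0ℤ | range (p 0) | count-nonzero ε (p ∘ suc) s≢0 range n
... | yes ε≡0 | _        | ih = trans ih (trans (sym (ℤP.+-identityˡ _))
  (cong (ℤ._+ sum (ε ∘ p ∘ suc) n) (sym ε≡0)))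
... | no  ε≢0 | inj₁ ε≡0 | ih = contradiction ε≡0 ε≢0
... | no  _   | inj₂ ε≡s | ih = trans (ℤP.*-suc s _) (cong₂ ℤ._+_ (sym ε≡s) ih)

-- Signs and integers in a short interval.

sign-cases : ∀ n → -1ℤ ℤ.^ n ≡ 1ℤ ⊎ -1ℤ ℤ.^ n ≡ -1ℤ
sign-cases zero = inj₁ refl
sign-cases (suc n) with sign-cases n
... | inj₁ e = inj₂ (cong (-1ℤ ℤ.*_) e)
... | inj₂ e = inj₁ (cong (-1ℤ ℤ.*_) e)

sign≢0 : ∀ n → -1ℤ ℤ.^ n ≢ 0ℤ
sign≢0 n with sign-cases n
... | inj₁ e = λ e′ → contradiction (trans (sym e) e′) λ ()
... | inj₂ e = λ e′ → contradiction (trans (sym e) e′) λ ()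

G-nonneg : ∀ m i → ∃[ g ] G m i ≡ + g
G-nonneg m zero = 0 , refl
G-nonneg m (suc zero) = 1 , refl
G-nonneg m (suc (suc i)) with G-nonneg m (suc i) | G-nonneg m i
... | g , e | g′ , e′ = m ℕ.* g ℕ.+ g′ ,
  cong₂ ℤ._+_ (trans (cong (+ m ℤ.*_) e) (sym (ℤP.pos-* m g))) e′

-1<e<2⇒e≡0∨1 : ∀ e → -1ℤ ℤ.< e → e ℤ.< + 2 → e ≡ 0ℤ ⊎ e ≡ 1ℤ
-1<e<2⇒e≡0∨1 (+ 0) _ _ = inj₁ refl
-1<e<2⇒e≡0∨1 (+ 1) _ _ = inj₂ refl
-1<e<2⇒e≡0∨1 (+ suc (suc _)) _ (ℤ.+<+ (ℕ.s≤s (ℕ.s≤s ())))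
-1<e<2⇒e≡0∨1 -[1+ _ ] (ℤ.-<- ()) _

-2<e<1⇒e≡0∨-1 : ∀ e → -[1+ 1 ] ℤ.< e → e ℤ.< 1ℤ → e ≡ 0ℤ ⊎ e ≡ -1ℤ
-2<e<1⇒e≡0∨-1 (+ 0) _ _ = inj₁ refl
-2<e<1⇒e≡0∨-1 (+ suc _) _ (ℤ.+<+ (ℕ.s≤s ()))
-2<e<1⇒e≡0∨-1 -[1+ 0 ] _ _ = inj₂ refl
-2<e<1⇒e≡0∨-1 -[1+ suc _ ] (ℤ.-<- (ℕ.s≤s ())) _

ι-0<-⇒< : ∀ {a b} → 0ℚ ℚ.< ι b ℚ.- ι a → a ℤ.< b
ι-0<-⇒< {a} {b} 0<b-a = ι-cancel-< (subst₂ ℚ._<_ (ℚP.+-identityˡ (ι a))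
  (solve 2 (λ a b → b :- a :+ a := b) refl (ι a) (ι b)) (ℚP.+-monoˡ-< (ι a) 0<b-a))

-- The integer e lies within distance less than 1 of sp, where 0 < p < 1. For s = 1 this puts e
-- strictly between -1 and 2, for s = -1 strictly between -2 and 1. Adding p or 1 - p makes the
-- bounds constant, hence comparisons of integers.
≡0∨≡sign : ∀ {s} {p : ℕ → ℚ} e → s ≡ 1ℤ ⊎ s ≡ -1ℤ → Pos p → Pos (λ n → 1ℚ ℚ.- p n) →
  Pos (λ n → 1ℚ ℚ.+ ι s ℚ.* p n ℚ.- ι e) → Pos (λ n → 1ℚ ℚ.+ ι e ℚ.- ι s ℚ.* p n) →
  e ≡ 0ℤ ⊎ e ≡ s
≡0∨≡sign {p = p} e (inj₁ refl) p-Pos 1-p-Pos above below = -1<e<2⇒e≡0∨1 e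
  (ι-0<-⇒< (Pos-const⁻¹ (Pos-ext
    (λ n → solve 2 (λ e p → con 1ℚ :+ e :- con 1ℚ :* p :+ p := e :- con (ι -1ℤ))
      refl (ι e) (p n))
    (Pos-+ below p-Pos))))
  (ι-0<-⇒< (Pos-const⁻¹ (Pos-ext
    (λ n → solve 2 (λ e p → con 1ℚ :+ con 1ℚ :* p :- e :+ (con 1ℚ :- p)
                         := con (ι (+ 2)) :- e) refl (ι e) (p n))
    (Pos-+ above 1-p-Pos))))
≡0∨≡sign {p = p} e (inj₂ refl) p-Pos 1-p-Pos above below = -2<e<1⇒e≡0∨-1 e
  (ι-0<-⇒< (Pos-const⁻¹ (Pos-ext
    (λ n → solve 2 (λ e p → con 1ℚ :+ e :- con (ι -1ℤ) :* p :+ (con 1ℚ :- p)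
                         := e :- con (ι -[1+ 1 ])) refl (ι e) (p n))
    (Pos-+ below 1-p-Pos))))
  (ι-0<-⇒< (Pos-const⁻¹ (Pos-ext
    (λ n → solve 2 (λ e p → con 1ℚ :+ con (ι -1ℤ) :* p :- e :+ p
                         := con 1ℚ :- e) refl (ι e) (p n))
    (Pos-+ above p-Pos))))

-- For s = -1 the upper and the lower bound change places, so they have to be treated as a pair.
cancel-sign : ∀ {s} {p : ℕ → ℚ} {g N C} → s ≡ 1ℤ ⊎ s ≡ -1ℤ →
  NonNeg (λ n → g ℚ.+ N ℚ.* (ι s ℚ.* p n) ℚ.- ι s ℚ.* C) ×
  NonNeg (λ n → g ℚ.+ ι s ℚ.* C ℚ.- N ℚ.* (ι s ℚ.* p n)) →
  NonNeg (λ n → g ℚ.+ N ℚ.* p n ℚ.- C) × NonNeg (λ n → g ℚ.+ C ℚ.- N ℚ.* p n)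
cancel-sign {p = p} {g} {N} {C} (inj₁ refl) (above , below) =
  NonNeg-ext (λ n → solve 4 (λ g N p C → g :+ N :* (con 1ℚ :* p) :- con 1ℚ :* C
      := g :+ N :* p :- C) refl g N (p n) C) above ,
  NonNeg-ext (λ n → solve 4 (λ g N p C → g :+ con 1ℚ :* C :- N :* (con 1ℚ :* p)
      := g :+ C :- N :* p) refl g N (p n) C) below
cancel-sign {p = p} {g} {N} {C} (inj₂ refl) (above , below) =
  NonNeg-ext (λ n → solve 4 (λ g N p C →
      g :+ con (ι -1ℤ) :* C :- N :* (con (ι -1ℤ) :* p)
      := g :+ N :* p :- C) refl g N (p n) C) below ,
  NonNeg-ext (λ n → solve 4 (λ g N p C →
      g :+ N :* (con (ι -1ℤ) :* p) :- con (ι -1ℤ) :* C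
      := g :+ C :- N :* p) refl g N (p n) C) above

-- Passage between reals and rational sequences, floors and limits.

<⇒Pos : ∀ {x y} → x < y → Pos (λ n → seq y n ℚ.- seq x n)
<⇒Pos {x} {y} (δ , 0<δ , h) = pos 0<δ (eventually-map
  (λ n p → 0≤q-p⇒p≤q (subst (0ℚ ℚ.≤_)
    (solve 3 (λ y x δ → y :- (x :+ δ) := y :- x :- δ) refl (seq y n) (seq x n) δ)
    (p≤q⇒0≤q-p p))) h)

Pos⇒< : ∀ {x y} → Pos (λ n → seq y n ℚ.- seq x n) → x < y
Pos⇒< {x} {y} (pos {δ} 0<δ h) = δ , 0<δ , eventually-map
  (λ n p → 0≤q-p⇒p≤q (subst (0ℚ ℚ.≤_)
    (solve 3 (λ y x δ → y :- x :- δ := y :- (x :+ δ)) refl (seq y n) (seq x n) δ)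
    (p≤q⇒0≤q-p p))) h

NonNeg⇒≤ : ∀ {x y} → NonNeg (λ n → seq y n ℚ.- seq x n) → x ≤ y
NonNeg⇒≤ {x} {y} h y<x = ℚP.<-irrefl refl (Pos-const⁻¹ (Pos-ext
  (λ n → solve 2 (λ x y → x :- y :+ (y :- x) := con 0ℚ) refl (seq x n) (seq y n))
  (Pos-+-NonNeg (<⇒Pos {y} {x} y<x) h)))

p≤∣p∣ : ∀ p → p ℚ.≤ ℚ.∣ p ∣
p≤∣p∣ p with ℚP.≤-total 0ℚ p
... | inj₁ 0≤p = ℚP.≤-reflexive (sym (ℚP.0≤p⇒∣p∣≡p 0≤p))
... | inj₂ p≤0 = ℚP.≤-trans p≤0 (ℚP.0≤∣p∣ p)

∣p∣<η⇒0≤p+η : ∀ p {η} → ℚ.∣ p ∣ ℚ.< η → 0ℚ ℚ.≤ p ℚ.+ η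
∣p∣<η⇒0≤p+η p {η} ∣p∣<η = subst (0ℚ ℚ.≤_)
  (solve 2 (λ p η → η :- (:- p) := p :+ η) refl p η)
  (p≤q⇒0≤q-p (ℚP.≤-trans (subst (ℚ.- p ℚ.≤_) (ℚP.∣-p∣≡∣p∣ p) (p≤∣p∣ (ℚ.- p)))
    (ℚP.<⇒≤ ∣p∣<η)))

≈⇒Null : ∀ {x y} → x ≈ y → Null (λ n → seq x n ℚ.- seq y n)
≈⇒Null {x} {y} x≈y =
  nonNeg (λ 0<η → eventually-map (λ n → ∣p∣<η⇒0≤p+η (d n)) (x≈y _ 0<η)) ,
  nonNeg (λ {η} 0<η → eventually-map (λ n p →
    ∣p∣<η⇒0≤p+η (ℚ.- d n) (subst (ℚ._< η) (sym (ℚP.∣-p∣≡∣p∣ (d n))) p)) (x≈y _ 0<η))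
  where
  d : ℕ → ℚ
  d n = seq x n ℚ.- seq y n

-- The description k ≤ x < k + 1. Unlike the maximality in `⌊_⌋≡_`, it supplies inequalities that
-- can enter linear combinations.
record IsFloor (x : ℕ → ℚ) (k : ℤ) : Set where
  constructor isFloor
  field
    lower : NonNeg (λ n → x n ℚ.- ι k)
    upper : Pos (λ n → 1ℚ ℚ.+ ι k ℚ.- x n)

open IsFloor

⌊⌋≡-unique : ∀ {x k l} → ⌊ x ⌋≡ k → ⌊ x ⌋≡ l → k ≡ l
⌊⌋≡-unique (k≤x , k-max) (l≤x , l-max) = ℤP.≤-antisym (l-max _ k≤x) (k-max _ l≤x)

IsFloor⇒⌊⌋≡ : ∀ {x k} → IsFloor (seq x) k → ⌊ x ⌋≡ k
IsFloor⇒⌊⌋≡ {x} {k} (isFloor lo up) = NonNeg⇒≤ {fromℤ k} {x} lo , greatest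
  where
  greatest : ∀ l → fromℤ l ≤ x → l ℤ.≤ k
  greatest l l≤x with l ℤ.≤? k
  ... | yes l≤k = l≤k
  -- From l > k follows l ≥ k + 1 > x, against l ≤ x.
  ... | no  l≰k = contradiction (Pos⇒< {x} {fromℤ l} (Pos-ext
    (λ n → solve 3 (λ k x l → con 1ℚ :+ k :- x :+ (l :- (con 1ℚ :+ k)) := l :- x)
      refl (ι k) (seq x n) (ι l))
    (Pos-+-NonNeg up (NonNeg-const (p≤q⇒0≤q-p
      (subst (ℚ._≤ ι l) (ι-+ 1ℤ k) (ι-mono-≤ (ℤP.i<j⇒suc[i]≤j (ℤP.≰⇒> l≰k)))))))))
    l≤x

-- If a(n) stays within g of (d(n) + 1)x, the quotient is within (1 + g) / (d(n) + 1) of x, the 1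
-- being the slack. This is at most h once n is large, as d(n) ≥ n.
bounded-discrepancy⇒⟶ : ∀ (a d : ℕ → ℕ) (x : ℝ) (g : ℕ) → (∀ n → n ℕ.≤ d n) →
  (∀ n → NonNeg (λ k → ι (+ g) ℚ.+ ι (+ suc (d n)) ℚ.* seq x k ℚ.- ι (+ a n)) ×
         NonNeg (λ k → ι (+ g) ℚ.+ ι (+ a n) ℚ.- ι (+ suc (d n)) ℚ.* seq x k)) →
  (λ n → fromℚ (+ a n ℚ./ suc (d n))) ⟶ x
bounded-discrepancy⇒⟶ a d x g n≤dn discrepancy δ 0<δ = from-gap (<⇒Pos {0ℝ} {δ} 0<δ)
  where
  from-gap : Pos (λ k → seq δ k ℚ.- 0ℚ) →
    ∃[ N ] (∀ n → N ℕ.≤ n → ∣ fromℚ (+ a n ℚ./ suc (d n)) - x ∣ < δ)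
  from-gap (pos {e} 0<e e≤δ) = n₀ , λ n n₀≤n → h , 0<h ,
    eventually-map₂ (λ k (p , q) e≤ → ℚP.≤-trans
      (ℚP.+-monoˡ-≤ h (∣C/N-y∣≤h {g = ι (+ g)} (0<ι (d n)) (suc*[/suc] (+ a n) (d n))
        (1+g≤Nh n n₀≤n) p q))
      (subst₂ ℚ._≤_ (solve 1 (λ e → e := con ½ :* e :+ con ½ :* e) refl e)
        (solve 1 (λ s → s :- con 0ℚ := s) refl (seq δ k)) e≤))
      (eventually-map₂ (λ _ → _,_) (0≤+ (proj₁ (discrepancy n)) 0<1)
        (0≤+ (proj₂ (discrepancy n)) 0<1)) e≤δ
    where
    -- Half of the gap e bounds the error; the other half witnesses the strict inequality with δ.
    h : ℚ
    h = ½ ℚ.* e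

    0<h : 0ℚ ℚ.< h
    0<h = 0<* 0<½ 0<e

    n₀ : ℕ
    n₀ = proj₁ (archimedean (suc g) 0<h)

    1+g≤Nh : ∀ n → n₀ ℕ.≤ n → 1ℚ ℚ.+ ι (+ g) ℚ.≤ ι (+ suc (d n)) ℚ.* h
    1+g≤Nh n n₀≤n = ℚP.≤-trans (ℚP.≤-reflexive (sym (ι-suc g)))
      (ℚP.≤-trans (proj₂ (archimedean (suc g) 0<h))
        (ℚP.*-monoʳ-≤-nonNeg h {{ℚ.nonNegative (ℚP.<⇒≤ 0<h)}}
          (ι-mono-≤ (ℤ.+≤+ (ℕP.≤-trans n₀≤n (ℕP.≤-trans (n≤dn n) (ℕP.n≤1+n (d n))))))))

-- Comparison of multiples of β with integers, and their floors.

module QuadraticRoot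
  (m : ℕ) (β : ℝ) (0<β : 0ℝ < β) (β<1 : β < 1ℝ)
  (root : β ^ 2 + fromℤ (+ m) * β ≈ 1ℝ)
  where

  b : ℕ → ℚ
  b = seq β

  M : ℚ
  M = ι (+ m)

  b-Pos : Pos b
  b-Pos = Pos-ext (λ n → ℚP.+-identityʳ (b n)) (<⇒Pos {0ℝ} {β} 0<β)

  1-b-Pos : Pos (λ n → 1ℚ ℚ.- b n)
  1-b-Pos = <⇒Pos {β} {1ℝ} β<1

  b²+Mb-1-Null : Null (λ n → b n ℚ.* b n ℚ.+ M ℚ.* b n ℚ.- 1ℚ)
  b²+Mb-1-Null = Null-ext
    (λ n → solve 2 (λ b M → b :* (b :* con 1ℚ) :+ M :* b :- con 1ℚ
                         := b :* b :+ M :* b :- con 1ℚ) refl (b n) M)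
    (≈⇒Null {β ^ 2 + fromℤ (+ m) * β} {1ℝ} root)

  -- Trichotomy is not constructively available for arbitrary reals; the quadratic equation of β
  -- makes it available here.
  Comparison : ℚ → ℚ → Set
  Comparison J K =
    Pos (λ n → b n ℚ.* J ℚ.- K) ⊎ Null (λ n → b n ℚ.* J ℚ.- K) ⊎
    Pos (λ n → K ℚ.- b n ℚ.* J)

  -- The sign of bJ − K is that of (bJ − K)(bJ + K + MJ), which differs from
  -- the rational number J² − K² − MJK by a null sequence.
  compare : ∀ J K → 0ℚ ℚ.< J → Comparison J K
  -- For K ≤ 0 the positivity of βJ decides. For K > 0 the second factor is bounded away from 0 and
  -- can be cancelled.
  compare J K 0<J with K ℚ.≤? 0ℚ
  ... | yes K≤0 = inj₁ (Pos-+-NonNeg (Pos-* b-Pos (Pos-const 0<J))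
    (NonNeg-const (subst (0ℚ ℚ.≤_) (ℚP.+-identityˡ (ℚ.- K)) (p≤q⇒0≤q-p K≤0))))
  ... | no  K≰0 = by-sign (ℚP.<-cmp 0ℚ c)
    where
    0<K : 0ℚ ℚ.< K
    0<K = ℚP.≰⇒> K≰0

    0≤MJ : 0ℚ ℚ.≤ M ℚ.* J
    0≤MJ = 0≤* (0≤ι m) (ℚP.<⇒≤ 0<J)

    c B : ℚ
    c = J ℚ.* J ℚ.- K ℚ.* K ℚ.- M ℚ.* J ℚ.* K
    B = J ℚ.+ (K ℚ.+ M ℚ.* J)

    d v : ℕ → ℚ
    d n = J ℚ.* J ℚ.* (b n ℚ.* b n ℚ.+ M ℚ.* b n ℚ.- 1ℚ)
    v n = b n ℚ.* J ℚ.+ (K ℚ.+ M ℚ.* J)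

    d-Null : Null d
    d-Null = Null-scale (0≤* (ℚP.<⇒≤ 0<J) (ℚP.<⇒≤ 0<J)) b²+Mb-1-Null

    0<B : 0ℚ ℚ.< B
    0<B = ℚP.+-mono-<-≤ 0<J (ℚP.+-mono-≤ (ℚP.<⇒≤ 0<K) 0≤MJ)

    v-Pos : Pos v
    v-Pos = Pos-+-NonNeg (Pos-* b-Pos (Pos-const 0<J))
      (NonNeg-const (ℚP.+-mono-≤ (ℚP.<⇒≤ 0<K) 0≤MJ))

    -- `B` is the value of `v` at β = 1, an upper bound because β < 1.
    B-v-Pos : Pos (λ n → B ℚ.- v n)
    B-v-Pos = Pos-ext
      (λ n → solve 3 (λ b J e → (con 1ℚ :- b) :* J := J :+ e :- (b :* J :+ e))
        refl (b n) J (K ℚ.+ M ℚ.* J))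
      (Pos-* 1-b-Pos (Pos-const 0<J))

    factor : ∀ n → c ℚ.+ d n ≡ (b n ℚ.* J ℚ.- K) ℚ.* v n
    factor n = solve 4 (λ b J K M →
      J :* J :- K :* K :- M :* J :* K :+ J :* J :* (b :* b :+ M :* b :- con 1ℚ)
        := (b :* J :- K) :* (b :* J :+ (K :+ M :* J))) refl (b n) J K M

    factor⁻ : ∀ n → ℚ.- c ℚ.+ ℚ.- d n ≡ (K ℚ.- b n ℚ.* J) ℚ.* v n
    factor⁻ n = trans (sym (ℚP.neg-distrib-+ c (d n))) (trans (cong ℚ.-_ (factor n))
      (solve 3 (λ x K v → :- ((x :- K) :* v) := (K :- x) :* v)
        refl (b n ℚ.* J) K (v n)))

    by-sign : Tri (0ℚ ℚ.< c) (0ℚ ≡ c) (c ℚ.< 0ℚ) → Comparison J K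
    by-sign (tri< 0<c _ _) = inj₁ (Pos-*-cancelʳ B 0<B
      (Pos-ext factor (Pos-+-NonNeg (Pos-const 0<c) (proj₁ d-Null))) v-Pos B-v-Pos)
    by-sign (tri≈ _ 0≡c _) = inj₂ (inj₁
      ( NonNeg-*-cancelʳ (NonNeg-ext factor
          (NonNeg-+ (NonNeg-const (ℚP.≤-reflexive 0≡c)) (proj₁ d-Null))) v-Pos
      , NonNeg-ext (λ n → solve 2 (λ x K → K :- x := :- (x :- K)) refl (b n ℚ.* J) K)
          (NonNeg-*-cancelʳ (NonNeg-ext factor⁻
            (NonNeg-+ (NonNeg-const (ℚP.≤-reflexive (cong ℚ.-_ 0≡c)))
              (proj₂ d-Null))) v-Pos)))
    by-sign (tri> _ _ c<0) = inj₂ (inj₂ (Pos-*-cancelʳ B 0<B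
      (Pos-ext factor⁻ (Pos-+-NonNeg (Pos-const (ℚP.neg-antimono-< c<0)) (proj₂ d-Null)))
      v-Pos B-v-Pos))

  -- Since `compare` needs a positive multiplier, a negative j is handled by comparing -βj with -k,
  -- and j = 0 is a comparison of rationals. Equality counts as the first alternative, as a floor
  -- requires.
  ≤-or-> : ∀ j k →
    NonNeg (λ n → b n ℚ.* ι j ℚ.- ι k) ⊎ Pos (λ n → ι k ℚ.- b n ℚ.* ι j)
  ≤-or-> (+ zero) k with ι k ℚ.≤? 0ℚ
  ... | yes k≤0 = inj₁ (NonNeg-ext
    (λ n → solve 2 (λ b k → con 0ℚ :- k := b :* con 0ℚ :- k) refl (b n) (ι k))
    (NonNeg-const (p≤q⇒0≤q-p k≤0)))
  ... | no  k≰0 = inj₂ (Pos-ext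
    (λ n → solve 2 (λ b k → k := k :- b :* con 0ℚ) refl (b n) (ι k))
    (Pos-const (ℚP.≰⇒> k≰0)))
  ≤-or-> (+ suc p) k with compare (ι (+ suc p)) (ι k) (0<ι p)
  ... | inj₁ h        = inj₁ (Pos⇒NonNeg h)
  ... | inj₂ (inj₁ h) = inj₁ (proj₁ h)
  ... | inj₂ (inj₂ h) = inj₂ h
  ≤-or-> -[1+ p ] k = by-reflection (compare J (ℚ.- ι k) (0<ι p))
    where
    J : ℚ
    J = ι (+ suc p)

    reflect : ∀ n → ℚ.- ι k ℚ.- b n ℚ.* J ≡ b n ℚ.* ι -[1+ p ] ℚ.- ι k
    reflect n = trans
      (solve 3 (λ k b J → :- k :- b :* J := b :* (:- J) :- k) refl (ι k) (b n) J)
      (cong (λ J → b n ℚ.* J ℚ.- ι k) (sym (ι-neg (+ suc p))))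

    by-reflection : Comparison J (ℚ.- ι k) →
      NonNeg (λ n → b n ℚ.* ι -[1+ p ] ℚ.- ι k) ⊎
      Pos (λ n → ι k ℚ.- b n ℚ.* ι -[1+ p ])
    by-reflection (inj₁ h) = inj₂ (Pos-ext (λ n → trans
      (solve 3 (λ k b J → b :* J :- (:- k) := k :- b :* (:- J)) refl (ι k) (b n) J)
      (cong (λ J → ι k ℚ.- b n ℚ.* J) (sym (ι-neg (+ suc p))))) h)
    by-reflection (inj₂ (inj₁ h)) = inj₁ (NonNeg-ext (λ n → trans
      (solve 3 (λ k b J → :- (b :* J :- (:- k)) := :- k :- b :* J) refl (ι k) (b n) J)
      (reflect n)) (proj₂ h))
    by-reflection (inj₂ (inj₂ h)) = inj₁ (NonNeg-ext reflect (Pos⇒NonNeg h))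

  -- The floor is sought downwards in l ≤ βj < l + n. If βj reaches the largest candidate, that is
  -- the floor; otherwise the interval loses its top element. An empty interval is contradictory.
  floor-search : ∀ j l n → NonNeg (λ i → b i ℚ.* ι j ℚ.- ι l) →
    Pos (λ i → ι (+ n) ℚ.+ ι l ℚ.- b i ℚ.* ι j) →
    ∃[ k ] IsFloor (λ i → b i ℚ.* ι j) k
  floor-search j l zero lo up = contradiction
    (Pos-const⁻¹ (Pos-ext
      (λ i → solve 2 (λ x l → con 0ℚ :+ l :- x :+ (x :- l) := con 0ℚ)
        refl (b i ℚ.* ι j) (ι l))
      (Pos-+-NonNeg up lo)))
    (ℚP.<-irrefl refl)
  floor-search j l (suc n) lo up with ≤-or-> j (+ n ℤ.+ l)
  ... | inj₁ h = + n ℤ.+ l , isFloor h (Pos-ext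
    (λ i → cong (ℚ._- b i ℚ.* ι j) (trans (cong (ℚ._+ ι l) (ι-suc n))
      (trans (ℚP.+-assoc 1ℚ (ι (+ n)) (ι l)) (cong (1ℚ ℚ.+_) (sym (ι-+ (+ n) l)))))) up)
  ... | inj₂ h = floor-search j l n lo
    (Pos-ext (λ i → cong (ℚ._- b i ℚ.* ι j) (ι-+ (+ n) l)) h)

  abstract
    -- The search starts from 0 ≤ βj < j + 1 for j ≥ 0, and from j ≤ βj < 0 for j < 0.
    floor : ∀ j → ∃[ k ] IsFloor (λ i → b i ℚ.* ι j) k
    floor (+ p) = floor-search (+ p) 0ℤ (suc p)
      (NonNeg-ext (λ i → solve 2 (λ b J → J :* b := b :* J :- con 0ℚ) refl (b i) (ι (+ p)))
        (NonNeg-scale (0≤ι p) (Pos⇒NonNeg b-Pos)))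
      (Pos-ext (λ i → trans
        (solve 2 (λ b J → con 1ℚ :+ J :* (con 1ℚ :- b) := (con 1ℚ :+ J) :+ con 0ℚ :- b :* J)
          refl (b i) (ι (+ p)))
        (cong (λ x → x ℚ.+ 0ℚ ℚ.- b i ℚ.* ι (+ p)) (sym (ι-suc p))))
        (Pos-+-NonNeg (Pos-const 0<1) (NonNeg-scale (0≤ι p) (Pos⇒NonNeg 1-b-Pos))))
    floor -[1+ p ] = floor-search -[1+ p ] -[1+ p ] (suc p)
      (NonNeg-ext (λ i → trans
        (solve 2 (λ b J → J :* (con 1ℚ :- b) := b :* (:- J) :- (:- J)) refl (b i) J)
        (cong (λ x → b i ℚ.* x ℚ.- x) (sym (ι-neg (+ suc p)))))
        (NonNeg-scale (0≤ι (suc p)) (Pos⇒NonNeg 1-b-Pos)))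
      (Pos-ext (λ i → trans
        (solve 2 (λ b J → b :* J := J :+ (:- J) :- b :* (:- J)) refl (b i) J)
        (cong (λ x → J ℚ.+ x ℚ.- b i ℚ.* x) (sym (ι-neg (+ suc p)))))
        (Pos-* b-Pos (Pos-const (0<ι p))))
      where
      J : ℚ
      J = ι (+ suc p)

  f : ℤ → ℤ
  f j = proj₁ (floor j)

  f-lower : ∀ j → NonNeg (λ n → b n ℚ.* ι j ℚ.- ι (f j))
  f-lower j = lower (proj₂ (floor j))

  f-upper : ∀ j → Pos (λ n → 1ℚ ℚ.+ ι (f j) ℚ.- b n ℚ.* ι j)
  f-upper j = upper (proj₂ (floor j))

  f-⌊⌋≡ : ∀ j → ⌊ β * fromℤ j ⌋≡ f j
  f-⌊⌋≡ j = IsFloor⇒⌊⌋≡ {β * fromℤ j} (proj₂ (floor j))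

  -- Powers of β and their relation to the sequence G.

  pow-Pos : ∀ i → Pos (seq (β ^ suc i))
  pow-Pos zero    = Pos-* b-Pos (Pos-const 0<1)
  pow-Pos (suc i) = Pos-* b-Pos (pow-Pos i)

  -- Induction through 1 - βp = (1 - β) + β(1 - p), starting at exponent 1 because 1 - β^0 vanishes.
  1-pow-Pos : ∀ i → Pos (λ n → 1ℚ ℚ.- seq (β ^ suc i) n)
  1-pow-Pos zero = Pos-ext
    (λ n → solve 1 (λ b → con 1ℚ :- b := con 1ℚ :- b :* con 1ℚ) refl (b n)) 1-b-Pos
  1-pow-Pos (suc i) = Pos-ext
    (λ n → solve 2 (λ b p → con 1ℚ :- b :+ b :* (con 1ℚ :- p) := con 1ℚ :- b :* p)
      refl (b n) (seq (β ^ suc i) n))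
    (Pos-+ 1-b-Pos (Pos-* b-Pos (1-pow-Pos i)))

  -- From here on i stands for the theorem's index minus one; the exponent keeps the theorem's form
  -- at `suc i`.
  sign : ℕ → ℤ
  sign i = -1ℤ ℤ.^ (suc i ℕ.+ 1)

  ι-sign-suc : ∀ i → ι (sign (suc i)) ≡ ℚ.- ι (sign i)
  ι-sign-suc i = trans (cong ι (ℤP.-1*i≡-i (sign i))) (ι-neg (sign i))

  Null-sign-scale : ∀ i {s} → Null s → Null (λ n → ι (sign i) ℚ.* s n)
  Null-sign-scale i {s} h with sign i | sign-cases (suc i ℕ.+ 1)
  ... | _ | inj₁ refl = Null-scale 0≤1 h
  ... | _ | inj₂ refl = Null-ext
    (λ n → solve 1 (λ x → :- x := con (ι -1ℤ) :* x) refl (s n)) (Null-neg h)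

  ι-G-suc-suc : ∀ i → ι (G m (suc (suc i))) ≡ M ℚ.* ι (G m (suc i)) ℚ.+ ι (G m i)
  ι-G-suc-suc i = trans (ι-+ (+ m ℤ.* G m (suc i)) (G m i))
    (cong (ℚ._+ ι (G m i)) (ι-* (+ m) (G m (suc i))))

  -- By the recurrence for G, the sequences E i below satisfy
  -- E (i + 2) = m E (i + 1) + E i − sign i · β ^ (i + 1) · (β² + mβ − 1).
  βG-Null : ∀ i → Null (λ n →
    b n ℚ.* ι (G m (suc i)) ℚ.- ι (G m i) ℚ.- ι (sign i) ℚ.* seq (β ^ suc i) n)
  βG-Null zero = Null-ext
    (λ n → solve 1 (λ b → con 0ℚ := b :* con 1ℚ :- con 0ℚ :- con 1ℚ :* (b :* con 1ℚ))
      refl (b n)) Null-0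
  -- Here G_2 = m and the sign is -1, so the sequence is β² + mβ - 1 itself.
  βG-Null (suc zero) = Null-ext
    (λ n → trans (solve 2 (λ b M → b :* b :+ M :* b :- con 1ℚ :=
        b :* (M :* con 1ℚ :+ con 0ℚ) :- con 1ℚ :- con (ι -1ℤ) :* (b :* (b :* con 1ℚ)))
        refl (b n) M)
      (cong (λ g → b n ℚ.* g ℚ.- 1ℚ ℚ.- ι -1ℤ ℚ.* (b n ℚ.* (b n ℚ.* 1ℚ)))
        (sym (ι-G-suc-suc 0)))) b²+Mb-1-Null
  βG-Null (suc (suc i)) = Null-ext recurrence
    (Null-+ (Null-+ (Null-scale (0≤ι m) (βG-Null (suc i))) (βG-Null i))
      (Null-neg (Null-sign-scale i
        (Null-*-unit b²+Mb-1-Null (pow-Pos i) (1-pow-Pos i)))))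
    where
    g₀ g₁ g₂ g₃ s₀ s₁ s₂ : ℚ
    g₀ = ι (G m i)
    g₁ = ι (G m (suc i))
    g₂ = ι (G m (suc (suc i)))
    g₃ = ι (G m (suc (suc (suc i))))
    s₀ = ι (sign i)
    s₁ = ι (sign (suc i))
    s₂ = ι (sign (suc (suc i)))

    algebra : ∀ b M g₀ g₁ {g₂ g₃} s₀ {s₁ s₂} p →
      g₂ ≡ M ℚ.* g₁ ℚ.+ g₀ → g₃ ≡ M ℚ.* g₂ ℚ.+ g₁ → s₁ ≡ ℚ.- s₀ → s₂ ≡ ℚ.- s₁ →
      M ℚ.* (b ℚ.* g₂ ℚ.- g₁ ℚ.- s₁ ℚ.* (b ℚ.* p)) ℚ.+
      (b ℚ.* g₁ ℚ.- g₀ ℚ.- s₀ ℚ.* p) ℚ.+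
      ℚ.- (s₀ ℚ.* ((b ℚ.* b ℚ.+ M ℚ.* b ℚ.- 1ℚ) ℚ.* p))
      ≡ b ℚ.* g₃ ℚ.- g₂ ℚ.- s₂ ℚ.* (b ℚ.* (b ℚ.* p))
    algebra b M g₀ g₁ s₀ p refl refl refl refl = solve 6 (λ b M g₀ g₁ s₀ p →
      M :* (b :* (M :* g₁ :+ g₀) :- g₁ :- (:- s₀) :* (b :* p)) :+
      (b :* g₁ :- g₀ :- s₀ :* p) :+
      :- (s₀ :* ((b :* b :+ M :* b :- con 1ℚ) :* p))
      := b :* (M :* (M :* g₁ :+ g₀) :+ g₁) :- (M :* g₁ :+ g₀)
         :- (:- (:- s₀)) :* (b :* (b :* p))) refl b M g₀ g₁ s₀ p

    recurrence : ∀ n →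
      M ℚ.* (b n ℚ.* g₂ ℚ.- g₁ ℚ.- s₁ ℚ.* (b n ℚ.* seq (β ^ suc i) n)) ℚ.+
      (b n ℚ.* g₁ ℚ.- g₀ ℚ.- s₀ ℚ.* seq (β ^ suc i) n) ℚ.+
      ℚ.- (s₀ ℚ.* ((b n ℚ.* b n ℚ.+ M ℚ.* b n ℚ.- 1ℚ) ℚ.* seq (β ^ suc i) n))
      ≡ b n ℚ.* g₃ ℚ.- g₂ ℚ.- s₂ ℚ.* (b n ℚ.* (b n ℚ.* seq (β ^ suc i) n))
    recurrence n = algebra (b n) M g₀ g₁ s₀ (seq (β ^ suc i) n)
      (ι-G-suc-suc i) (ι-G-suc-suc (suc i)) (ι-sign-suc i) (ι-sign-suc (suc i))

  -- The possible values of ε.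

  Step : ℕ → ℤ → ℤ → Set
  Step i j e = f (j ℤ.+ G m (suc i)) ≡ f j ℤ.+ G m i ℤ.+ e

  -- Uniqueness of the floor replaces the existential values in `Isε` by those of `f`.
  Isε⇒Step : ∀ i {j e} → Isε m β (suc i) j e → Step i j e
  Isε⇒Step i {j} {e} (k , l , ⌊⌋≡k , ⌊⌋≡l , l≡)
    = trans (⌊⌋≡-unique {β * fromℤ j′} (f-⌊⌋≡ j′) ⌊⌋≡l) (trans l≡
        (cong (λ k → k ℤ.+ G m i ℤ.+ e) (⌊⌋≡-unique {β * fromℤ j} ⌊⌋≡k (f-⌊⌋≡ j))))
    where
    j′ : ℤ
    j′ = j ℤ.+ G m (suc i)

  Step⇒Isε : ∀ i {j e} → Step i j e → Isε m β (suc i) j e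
  Step⇒Isε i {j} step =
    f j , f (j ℤ.+ G m (suc i)) , f-⌊⌋≡ j , f-⌊⌋≡ (j ℤ.+ G m (suc i)) , step

  ε₀ : ℕ → ℤ → ℤ
  ε₀ i j = f (j ℤ.+ G m (suc i)) ℤ.- (f j ℤ.+ G m i)

  ε₀-Step : ∀ i j → Step i j (ε₀ i j)
  ε₀-Step i j = ℤ-Solver.solve 2 (λ x y → x ⊜ y ⊕ (x ⊖ y)) refl
    (f (j ℤ.+ G m (suc i))) (f j ℤ.+ G m i)

  -- Since βG_{i+1} = G_i + sβ^(i+1), the difference e - sβ^(i+1) is the fractional part of βj minus
  -- that of β(j + G_{i+1}), hence strictly between -1 and 1.
  Step-bounds : ∀ i j e → Step i j e →
    Pos (λ n → 1ℚ ℚ.+ ι (sign i) ℚ.* seq (β ^ suc i) n ℚ.- ι e) ×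
    Pos (λ n → 1ℚ ℚ.+ ι e ℚ.- ι (sign i) ℚ.* seq (β ^ suc i) n)
  Step-bounds i j e step =
    Pos-ext (λ n → above (b n) (ι j) g₁ g₀ k (ι e) (sp n) (ι-+ j (G m (suc i))) ι-step)
      (Pos-+-NonNeg (Pos-+-NonNeg (f-upper j) (f-lower j′)) (proj₂ (βG-Null i))) ,
    Pos-ext (λ n → below (b n) (ι j) g₁ g₀ k (ι e) (sp n) (ι-+ j (G m (suc i))) ι-step)
      (Pos-+-NonNeg (Pos-+-NonNeg (f-upper j′) (f-lower j)) (proj₁ (βG-Null i)))
    where
    j′ : ℤ
    j′ = j ℤ.+ G m (suc i)

    g₀ g₁ k : ℚ
    g₀ = ι (G m i)
    g₁ = ι (G m (suc i))
    k  = ι (f j)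

    sp : ℕ → ℚ
    sp n = ι (sign i) ℚ.* seq (β ^ suc i) n

    ι-step : ι (f j′) ≡ k ℚ.+ g₀ ℚ.+ ι e
    ι-step = trans (cong ι step) (trans (ι-+ (f j ℤ.+ G m i) e)
      (cong (ℚ._+ ι e) (ι-+ (f j) (G m i))))

    above : ∀ b J g₁ g₀ k e p {J′ k′} → J′ ≡ J ℚ.+ g₁ → k′ ≡ k ℚ.+ g₀ ℚ.+ e →
      1ℚ ℚ.+ k ℚ.- b ℚ.* J ℚ.+ (b ℚ.* J′ ℚ.- k′) ℚ.+ ℚ.- (b ℚ.* g₁ ℚ.- g₀ ℚ.- p)
      ≡ 1ℚ ℚ.+ p ℚ.- e
    above b J g₁ g₀ k e p refl refl = solve 7 (λ b J g₁ g₀ k e p →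
      con 1ℚ :+ k :- b :* J :+ (b :* (J :+ g₁) :- (k :+ g₀ :+ e)) :+
        :- (b :* g₁ :- g₀ :- p)
      := con 1ℚ :+ p :- e) refl b J g₁ g₀ k e p

    below : ∀ b J g₁ g₀ k e p {J′ k′} → J′ ≡ J ℚ.+ g₁ → k′ ≡ k ℚ.+ g₀ ℚ.+ e →
      1ℚ ℚ.+ k′ ℚ.- b ℚ.* J′ ℚ.+ (b ℚ.* J ℚ.- k) ℚ.+ (b ℚ.* g₁ ℚ.- g₀ ℚ.- p)
      ≡ 1ℚ ℚ.+ e ℚ.- p
    below b J g₁ g₀ k e p refl refl = solve 7 (λ b J g₁ g₀ k e p →
      con 1ℚ :+ (k :+ g₀ :+ e) :- b :* (J :+ g₁) :+ (b :* J :- k) :+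
        (b :* g₁ :- g₀ :- p)
      := con 1ℚ :+ e :- p) refl b J g₁ g₀ k e p

  Step-range : ∀ i j e → Step i j e → e ≡ 0ℤ ⊎ e ≡ sign i
  Step-range i j e step = ≡0∨≡sign e (sign-cases (suc i ℕ.+ 1)) (pow-Pos i) (1-pow-Pos i)
    (proj₁ (Step-bounds i j e step)) (proj₂ (Step-bounds i j e step))

  -- Counting nonzero values of ε in an interval of integers.

  shift-discrepancy : ∀ o N g →
    NonNeg (λ n → ι (+ g) ℚ.+ ι (+ g) ℚ.* ι (+ N) ℚ.* b n ℚ.-
      ι (sum (λ k → f (+ (k ℕ.+ g) ℤ.+ o) ℤ.- f (+ k ℤ.+ o)) N)) ×
    NonNeg (λ n → ι (+ g) ℚ.+ ι (sum (λ k → f (+ (k ℕ.+ g) ℤ.+ o) ℤ.- f (+ k ℤ.+ o)) N)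
      ℚ.- ι (+ g) ℚ.* ι (+ N) ℚ.* b n)
  shift-discrepancy o N zero =
    NonNeg-ext (λ n → trans (solve 2 (λ N b → con 0ℚ := con 0ℚ :+ con 0ℚ :* N :* b :- con 0ℚ)
        refl (ι (+ N)) (b n))
      (cong (λ s → 0ℚ ℚ.+ 0ℚ ℚ.* ι (+ N) ℚ.* b n ℚ.- ι s) (sym S≡0)))
      (NonNeg-const ℚP.≤-refl) ,
    NonNeg-ext (λ n → trans (solve 2 (λ N b → con 0ℚ := con 0ℚ :+ con 0ℚ :- con 0ℚ :* N :* b)
        refl (ι (+ N)) (b n))
      (cong (λ s → 0ℚ ℚ.+ ι s ℚ.- 0ℚ ℚ.* ι (+ N) ℚ.* b n) (sym S≡0)))
      (NonNeg-const ℚP.≤-refl)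
    where
    S≡0 : sum (λ k → f (+ (k ℕ.+ 0) ℤ.+ o) ℤ.- f (+ k ℤ.+ o)) N ≡ 0ℤ
    S≡0 = sum-shift-zero (λ k → f (+ k ℤ.+ o)) N
  -- The new term is ⌊β(r + N)⌋ - ⌊βr⌋ with r = g + o. It differs from Nβ by less than 1, so the
  -- error bound grows from g to g + 1.
  shift-discrepancy o N (suc g) =
    NonNeg-ext (λ n → above (b n) (ι (+ g)) (ι (+ N)) (ι o) S (F (N ℕ.+ g)) (F g)
        ι-position ι-position′ (ι-suc g) ι-S′)
      (NonNeg-+ (proj₁ (shift-discrepancy o N g))
        (Pos⇒NonNeg (Pos-+-NonNeg (f-upper (+ g ℤ.+ o)) (f-lower (+ (N ℕ.+ g) ℤ.+ o))))) ,
    NonNeg-ext (λ n → below (b n) (ι (+ g)) (ι (+ N)) (ι o) S (F (N ℕ.+ g)) (F g)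
        ι-position ι-position′ (ι-suc g) ι-S′)
      (NonNeg-+ (proj₂ (shift-discrepancy o N g))
        (Pos⇒NonNeg (Pos-+-NonNeg (f-upper (+ (N ℕ.+ g) ℤ.+ o)) (f-lower (+ g ℤ.+ o)))))
    where
    F : ℕ → ℚ
    F k = ι (f (+ k ℤ.+ o))

    S S′ : ℚ
    S  = ι (sum (λ k → f (+ (k ℕ.+ g) ℤ.+ o) ℤ.- f (+ k ℤ.+ o)) N)
    S′ = ι (sum (λ k → f (+ (k ℕ.+ suc g) ℤ.+ o) ℤ.- f (+ k ℤ.+ o)) N)

    ι-position : ι (+ g ℤ.+ o) ≡ ι (+ g) ℚ.+ ι o
    ι-position = ι-+ (+ g) o

    ι-position′ : ι (+ (N ℕ.+ g) ℤ.+ o) ≡ ι (+ N) ℚ.+ ι (+ g) ℚ.+ ι o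
    ι-position′ = trans (ι-+ (+ (N ℕ.+ g)) o) (cong (ℚ._+ ι o) (ι-+ (+ N) (+ g)))

    ι-S′ : S′ ≡ S ℚ.+ (F (N ℕ.+ g) ℚ.- F g)
    ι-S′ = trans (cong ι (sum-shift-suc (λ k → f (+ k ℤ.+ o)) g N))
      (trans (ι-+ (sum (λ k → f (+ (k ℕ.+ g) ℤ.+ o) ℤ.- f (+ k ℤ.+ o)) N) _)
        (cong (S ℚ.+_) (ι-- (f (+ (N ℕ.+ g) ℤ.+ o)) (f (+ g ℤ.+ o)))))

    above : ∀ b g N o S F′ F {x x′ g′ S′} → x ≡ g ℚ.+ o → x′ ≡ N ℚ.+ g ℚ.+ o →
      g′ ≡ 1ℚ ℚ.+ g → S′ ≡ S ℚ.+ (F′ ℚ.- F) →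
      g ℚ.+ g ℚ.* N ℚ.* b ℚ.- S ℚ.+ (1ℚ ℚ.+ F ℚ.- b ℚ.* x ℚ.+ (b ℚ.* x′ ℚ.- F′))
      ≡ g′ ℚ.+ g′ ℚ.* N ℚ.* b ℚ.- S′
    above b g N o S F′ F refl refl refl refl = solve 7 (λ b g N o S F′ F →
      g :+ g :* N :* b :- S :+ (con 1ℚ :+ F :- b :* (g :+ o) :+ (b :* (N :+ g :+ o) :- F′))
      := con 1ℚ :+ g :+ (con 1ℚ :+ g) :* N :* b :- (S :+ (F′ :- F)))
      refl b g N o S F′ F

    below : ∀ b g N o S F′ F {x x′ g′ S′} → x ≡ g ℚ.+ o → x′ ≡ N ℚ.+ g ℚ.+ o →
      g′ ≡ 1ℚ ℚ.+ g → S′ ≡ S ℚ.+ (F′ ℚ.- F) →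
      g ℚ.+ S ℚ.- g ℚ.* N ℚ.* b ℚ.+ (1ℚ ℚ.+ F′ ℚ.- b ℚ.* x′ ℚ.+ (b ℚ.* x ℚ.- F))
      ≡ g′ ℚ.+ S′ ℚ.- g′ ℚ.* N ℚ.* b
    below b g N o S F′ F refl refl refl refl = solve 7 (λ b g N o S F′ F →
      g :+ S :- g :* N :* b :+ (con 1ℚ :+ F′ :- b :* (N :+ g :+ o) :+ (b :* (g :+ o) :- F))
      := con 1ℚ :+ g :+ (S :+ (F′ :- F)) :- (con 1ℚ :+ g) :* N :* b)
      refl b g N o S F′ F

  -- The interval starts at an arbitrary o; the symmetric one is the case o = -n, N = 2n + 1.
  #nonzero-from : (ℤ → ℤ) → ℤ → ℕ → ℕ
  #nonzero-from ε o N =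
    length (filter (λ j → ¬? (ε j ℤ.≟ 0ℤ)) (applyUpTo (λ k → + k ℤ.+ o) N))

  -- The shifted sum equals N G_i + sC, with C the count, and lies within g of gNβ. Adding or
  -- subtracting N times the null sequence of `βG-Null` turns gNβ - N G_i into Nsβ^(i+1). The
  -- natural number g represents G_{i+1} because the shift is treated by induction.
  signed-discrepancy : ∀ i ε → (∀ j → Step i j (ε j)) → ∀ {g} → G m (suc i) ≡ + g → ∀ o N →
    NonNeg (λ n → ι (+ g) ℚ.+ ι (+ N) ℚ.* (ι (sign i) ℚ.* seq (β ^ suc i) n)
      ℚ.- ι (sign i) ℚ.* ι (+ #nonzero-from ε o N)) ×
    NonNeg (λ n → ι (+ g) ℚ.+ ι (sign i) ℚ.* ι (+ #nonzero-from ε o N)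
      ℚ.- ι (+ N) ℚ.* (ι (sign i) ℚ.* seq (β ^ suc i) n))
  signed-discrepancy i ε step {g} G≡g o N =
    NonNeg-ext (λ n → above (b n) (ι (+ g)) (ι (G m i)) (ι (+ N)) (ι (sign i)) (p n) (ι C)
        (cong ι G≡g) ι-S)
      (NonNeg-+ (proj₁ (shift-discrepancy o N g)) (proj₂ defect)) ,
    NonNeg-ext (λ n → below (b n) (ι (+ g)) (ι (G m i)) (ι (+ N)) (ι (sign i)) (p n) (ι C)
        (cong ι G≡g) ι-S)
      (NonNeg-+ (proj₂ (shift-discrepancy o N g)) (proj₁ defect))
    where
    C S : ℤ
    C = + #nonzero-from ε o N
    S = sum (λ k → f (+ (k ℕ.+ g) ℤ.+ o) ℤ.- f (+ k ℤ.+ o)) N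

    p : ℕ → ℚ
    p = seq (β ^ suc i)

    defect : Null (λ n → ι (+ N) ℚ.*
      (b n ℚ.* ι (G m (suc i)) ℚ.- ι (G m i) ℚ.- ι (sign i) ℚ.* p n))
    defect = Null-scale (0≤ι N) (βG-Null i)

    position : ∀ k → + k ℤ.+ o ℤ.+ G m (suc i) ≡ + (k ℕ.+ g) ℤ.+ o
    position k = trans (cong (λ G → + k ℤ.+ o ℤ.+ G) G≡g)
      (ℤ-Solver.solve 3 (λ k o g → k ⊕ o ⊕ g ⊜ k ⊕ g ⊕ o) refl (+ k) o (+ g))

    difference : ∀ k → f (+ (k ℕ.+ g) ℤ.+ o) ℤ.- f (+ k ℤ.+ o) ≡ G m i ℤ.+ ε (+ k ℤ.+ o)
    difference k = trans
      (cong (ℤ._- f (+ k ℤ.+ o)) (trans (cong f (sym (position k))) (step (+ k ℤ.+ o))))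
      (ℤ-Solver.solve 3 (λ x G e → x ⊕ G ⊕ e ⊖ x ⊜ G ⊕ e) refl
        (f (+ k ℤ.+ o)) (G m i) (ε (+ k ℤ.+ o)))

    S≡ : S ≡ + N ℤ.* G m i ℤ.+ sign i ℤ.* C
    S≡ = trans (sum-const+ (G m i) difference N)
      (cong (ℤ._+_ (+ N ℤ.* G m i)) (sym (count-nonzero ε (λ k → + k ℤ.+ o)
        (sign≢0 (suc i ℕ.+ 1)) (λ j → Step-range i j (ε j) (step j)) N)))

    ι-S : ι S ≡ ι (+ N) ℚ.* ι (G m i) ℚ.+ ι (sign i) ℚ.* ι C
    ι-S = trans (cong ι S≡) (trans (ι-+ (+ N ℤ.* G m i) (sign i ℤ.* C))
      (cong₂ ℚ._+_ (ι-* (+ N) (G m i)) (ι-* (sign i) C)))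

    above : ∀ b g g₀ N s p C {g₁ S} → g₁ ≡ g → S ≡ N ℚ.* g₀ ℚ.+ s ℚ.* C →
      g ℚ.+ g ℚ.* N ℚ.* b ℚ.- S ℚ.+ ℚ.- (N ℚ.* (b ℚ.* g₁ ℚ.- g₀ ℚ.- s ℚ.* p))
      ≡ g ℚ.+ N ℚ.* (s ℚ.* p) ℚ.- s ℚ.* C
    above b g g₀ N s p C refl refl = solve 7 (λ b g g₀ N s p C →
      g :+ g :* N :* b :- (N :* g₀ :+ s :* C) :+ :- (N :* (b :* g :- g₀ :- s :* p))
      := g :+ N :* (s :* p) :- s :* C) refl b g g₀ N s p C

    below : ∀ b g g₀ N s p C {g₁ S} → g₁ ≡ g → S ≡ N ℚ.* g₀ ℚ.+ s ℚ.* C →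
      g ℚ.+ S ℚ.- g ℚ.* N ℚ.* b ℚ.+ N ℚ.* (b ℚ.* g₁ ℚ.- g₀ ℚ.- s ℚ.* p)
      ≡ g ℚ.+ s ℚ.* C ℚ.- N ℚ.* (s ℚ.* p)
    below b g g₀ N s p C refl refl = solve 7 (λ b g g₀ N s p C →
      g :+ (N :* g₀ :+ s :* C) :- g :* N :* b :+ N :* (b :* g :- g₀ :- s :* p)
      := g :+ s :* C :- N :* (s :* p)) refl b g g₀ N s p C

  discrepancy : ∀ i ε → (∀ j → Step i j (ε j)) → ∀ {g} → G m (suc i) ≡ + g → ∀ o N →
    NonNeg (λ n → ι (+ g) ℚ.+ ι (+ N) ℚ.* seq (β ^ suc i) n ℚ.- ι (+ #nonzero-from ε o N)) ×
    NonNeg (λ n → ι (+ g) ℚ.+ ι (+ #nonzero-from ε o N) ℚ.- ι (+ N) ℚ.* seq (β ^ suc i) n)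
  discrepancy i ε step {g} G≡g o N =
    cancel-sign {p = seq (β ^ suc i)} {ι (+ g)} {ι (+ N)} {ι (+ #nonzero-from ε o N)}
      (sign-cases (suc i ℕ.+ 1)) (signed-discrepancy i ε step G≡g o N)

  -- The frequency and the theorem.

  #nonzero≡#nonzero-from : ∀ ε n → #nonzero ε n ≡ #nonzero-from ε (ℤ.- + n) (suc (2 ℕ.* n))
  #nonzero≡#nonzero-from ε n = cong (length ∘ filter (λ j → ¬? (ε j ℤ.≟ 0ℤ)))
    (trans (map-upTo (λ k → + k ℤ.- + n) (suc (n ℕ.+ n)))
      -- `2 * n` unfolds to `n + (n + 0)`, so the two lengths differ by a right identity.
      (cong (λ k → applyUpTo (λ k → + k ℤ.- + n) (suc (n ℕ.+ k))) (sym (ℕP.+-identityʳ n))))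

  frequency⟶ : ∀ i ε → (∀ j → Step i j (ε j)) → frequency ε ⟶ β ^ suc i
  frequency⟶ i ε step = bounded-discrepancy⇒⟶ (#nonzero ε) (2 ℕ.*_) (β ^ suc i)
    (proj₁ (G-nonneg m (suc i))) (λ n → ℕP.m≤m+n n (n ℕ.+ 0)) centred
    where
    g : ℕ
    g = proj₁ (G-nonneg m (suc i))

    centred : ∀ n →
      NonNeg (λ k → ι (+ g) ℚ.+ ι (+ suc (2 ℕ.* n)) ℚ.* seq (β ^ suc i) k
        ℚ.- ι (+ #nonzero ε n)) ×
      NonNeg (λ k → ι (+ g) ℚ.+ ι (+ #nonzero ε n)
        ℚ.- ι (+ suc (2 ℕ.* n)) ℚ.* seq (β ^ suc i) k)
    centred n rewrite #nonzero≡#nonzero-from ε n =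
      discrepancy i ε step (proj₂ (G-nonneg m (suc i))) (ℤ.- + n) (suc (2 ℕ.* n))

theorem1 : ∀ (m : ℕ) → 1 ℕ.≤ m →
    ∀ (β : ℝ) → 0ℝ < β → β < 1ℝ → β ^ 2 + fromℤ (+ m) * β ≈ 1ℝ →
    ∀ (i : ℕ) → 1 ℕ.≤ i →
    (Σ[ ε ∈ (ℤ → ℤ) ] (∀ (j : ℤ) → Isε m β i j (ε j))) ×
    (∀ (ε : ℤ → ℤ) → (∀ (j : ℤ) → Isε m β i j (ε j)) →
    (∀ (j : ℤ) → ε j ≡ 0ℤ ⊎ ε j ≡ -1ℤ ℤ.^ (i ℕ.+ 1)) ×
    (frequency ε ⟶ β ^ i))
theorem1 m _ β 0<β β<1 root (suc i) _ =
  -- Existence comes from the computed floors; the remaining claims hold for every ε that satisfies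
  -- the defining equation.
  (ε₀ i , λ j → Step⇒Isε i (ε₀-Step i j)) ,
  λ ε isε → (λ j → Step-range i j (ε j) (Isε⇒Step i (isε j))) ,
    frequency⟶ i ε (λ j → Isε⇒Step i (isε j))
  where
  open QuadraticRoot m β 0<β β<1 root
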